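{- For every $A\in 2^{\mathbb{N}}$, $A$ strongly relativizes $\Delta^0_1$ at $\mathbb{N}$ if and only if $A$ is computably dominated. In particular, there are continuum-many reals which strongly relativize $\Delta^0_1$ at $\mathbb{N}$.
   Context: Elements of $2^{\mathbb{N}}$ are identified with subsets of $\mathbb{N}$ and are also regarded as elements of $\mathbb{N}^{\mathbb{N}}$ (reals). A set $Q\subseteq\mathbb{N}^{\mathbb{N}}\times\mathbb{N}$ is $\Sigma^0_1$ if it is a union of a c.e. family of basic open sets $[\sigma]\times\{n\}$, where $[\sigma]=\{h\in\mathbb{N}^{\mathbb{N}}:\sigma\sqsubset h\}$ for a finite sequence $\sigma$; it is $\Delta^0_1$ if both it and its complement are $\Sigma^0_1$. For $f\in\mathbb{N}^{\mathbb{N}}$, a set $B\subseteq\mathbb{N}$ is $\Delta^0_1(f)$ if both $B$ and its complement are $f$-sections $Q_f=\{n:Q(f,n)\}$ of $\Sigma^0_1$ sets $Q\subseteq\mathbb{N}^{\mathbb{N}}\times\mathbb{N}$ (equivalently, $B\le_T f$). A real $f\in\mathbb{N}^{\mathbb{N}}$ strongly relativizes $\Delta^0_1$ at $\mathbb{N}$ if every $\Delta^0_1(f)$ set $B\subseteq\mathbb{N}$ equals $Q_f$ for some $\Delta^0_1$ set $Q\subseteq\mathbb{N}^{\mathbb{N}}\times\mathbb{N}$. A real $f$ is computably dominated if for every $g\in\mathbb{N}^{\mathbb{N}}$ with $g\le_T f$ there is a computable $h\in\mathbb{N}^{\mathbb{N}}$ with $g(n)\le h(n)$ for all $n$. -}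

module Defs where

open import Level as Level using (0ℓ)
open import Data.Empty using (⊥; ⊥-elim)
open import Data.Fin.Base using (Fin)
open import Data.List.Base using (List; []; _∷_; length; applyUpTo)
open import Data.Nat.Base using (ℕ; suc; _+_; _*_; _^_; _≤_; _<_)
open import Data.Product.Base using (Σ; ∃; ∃-syntax; _×_; _,_; proj₁)
open import Data.Unit.Base using (⊤)
open import Data.Vec.Base using (Vec; []; _∷_; lookup)
open import Data.Vec.Relation.Binary.Pointwise.Inductive using (Pointwise)
open import Function.Bundles using (_⇔_)
open import Relation.Binary.Bundles using (Setoid)
open import Relation.Binary.PropositionalEquality using (_≡_; _→-setoid_)
import Relation.Binary.Construct.On as On
open import Relation.Unary using (Pred; _∈_; _≐_; ∁)

Real : Set
Real = ℕ → ℕ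

-- Partial recursive functions of arity n, relative to oracles named by the
-- elements of O; with O = ⊥ these are the unrelativized ones.
data Rec (O : Set) : ℕ → Set where
  zeroᴿ   : ∀ {n} → Rec O n
  sucᴿ    : Rec O 1
  projᴿ   : ∀ {n} → Fin n → Rec O n
  oracleᴿ : O → Rec O 1
  compᴿ   : ∀ {k n} → Rec O k → Vec (Rec O n) k → Rec O n
  precᴿ   : ∀ {n} → Rec O n → Rec O (2 + n) → Rec O (1 + n)
  minᴿ    : ∀ {n} → Rec O (1 + n) → Rec O n

-- φ ⊢ p [ xs ]⇓ y : with the oracles interpreted by φ, the function p
-- converges on xs, with value y.
data _⊢_[_]⇓_ {O : Set} (φ : O → Real) : ∀ {n} → Rec O n → Vec ℕ n → ℕ → Set where
  zero⇓   : ∀ {n} {xs : Vec ℕ n} → φ ⊢ zeroᴿ [ xs ]⇓ 0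
  suc⇓    : ∀ {x} → φ ⊢ sucᴿ [ x ∷ [] ]⇓ suc x
  proj⇓   : ∀ {n} {xs : Vec ℕ n} (i : Fin n) → φ ⊢ projᴿ i [ xs ]⇓ lookup xs i
  oracle⇓ : ∀ (o : O) {x} → φ ⊢ oracleᴿ o [ x ∷ [] ]⇓ φ o x
  comp⇓   : ∀ {k n} {p : Rec O k} {qs : Vec (Rec O n) k} {xs ys z} →
           Pointwise (λ q y → φ ⊢ q [ xs ]⇓ y) qs ys →
           φ ⊢ p [ ys ]⇓ z →
           φ ⊢ compᴿ p qs [ xs ]⇓ z
  prec-zero⇓ : ∀ {n} {p : Rec O n} {q : Rec O (2 + n)} {xs y} →
           φ ⊢ p [ xs ]⇓ y →
           φ ⊢ precᴿ p q [ 0 ∷ xs ]⇓ y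
  prec-suc⇓  : ∀ {n} {p : Rec O n} {q : Rec O (2 + n)} {m xs y z} →
           φ ⊢ precᴿ p q [ m ∷ xs ]⇓ y →
           φ ⊢ q [ m ∷ y ∷ xs ]⇓ z →
           φ ⊢ precᴿ p q [ suc m ∷ xs ]⇓ z
  min⇓    : ∀ {n} {p : Rec O (1 + n)} {xs y} →
           (∀ i → i < y → ∃[ z ] φ ⊢ p [ i ∷ xs ]⇓ suc z) →
           φ ⊢ p [ y ∷ xs ]⇓ 0 →
           φ ⊢ minᴿ p [ xs ]⇓ y

noOracle : ⊥ → Real
noOracle = ⊥-elim

Computable : Real → Set
Computable h = Σ (Rec ⊥ 1) λ p → ∀ n → noOracle ⊢ p [ n ∷ [] ]⇓ h n

infix 4 _≤T_
_≤T_ : Real → Real → Set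
g ≤T f = Σ (Rec ⊤ 1) λ p → ∀ n → (λ (_ : ⊤) → f) ⊢ p [ n ∷ [] ]⇓ g n

ComputablyDominated : Real → Set
ComputablyDominated f = ∀ g → g ≤T f → ∃[ h ] Computable h × (∀ n → g n ≤ h n)

-- A bijection between finite sequences and natural numbers.
code : List ℕ → ℕ
code []      = 0
code (a ∷ σ) = 2 ^ a * (1 + 2 * code σ)

-- A set is c.e. when it is the domain of a partial recursive function.
CE : Pred (List ℕ × ℕ) 0ℓ → Set
CE W = Σ (Rec ⊥ 2) λ p →
  ∀ σ n → (σ , n) ∈ W ⇔ (∃[ y ] noOracle ⊢ p [ code σ ∷ n ∷ [] ]⇓ y)

⟦_⟧ : List ℕ → Pred Real 0ℓ
⟦ σ ⟧ h = σ ≡ applyUpTo h (length σ)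

⋃⟦_⟧ : Pred (List ℕ × ℕ) 0ℓ → Pred (Real × ℕ) 0ℓ
⋃⟦ W ⟧ (h , n) = ∃[ σ ] (σ , n) ∈ W × h ∈ ⟦ σ ⟧

Σ⁰₁ : Pred (Real × ℕ) 0ℓ → Set₁
Σ⁰₁ Q = Σ (Pred (List ℕ × ℕ) 0ℓ) λ W → CE W × Q ≐ ⋃⟦ W ⟧

Δ⁰₁ : Pred (Real × ℕ) 0ℓ → Set₁
Δ⁰₁ Q = Σ⁰₁ Q × Σ⁰₁ (∁ Q)

section : Pred (Real × ℕ) 0ℓ → Real → Pred ℕ 0ℓ
section Q f n = Q (f , n)

Σ⁰₁[_] : Real → Pred ℕ 0ℓ → Set₁
Σ⁰₁[ f ] B = Σ (Pred (Real × ℕ) 0ℓ) λ Q → Σ⁰₁ Q × B ≐ section Q f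

Δ⁰₁[_] : Real → Pred ℕ 0ℓ → Set₁
Δ⁰₁[ f ] B = Σ⁰₁[ f ] B × Σ⁰₁[ f ] (∁ B)

StronglyRelativizesΔ⁰₁ : Real → Set₁
StronglyRelativizesΔ⁰₁ f = ∀ (B : Pred ℕ 0ℓ) → Δ⁰₁[ f ] B →
  Σ (Pred (Real × ℕ) 0ℓ) λ Q → Δ⁰₁ Q × B ≐ section Q f

-- Reals are compared by their values only, so the proof component does not
-- affect the cardinality.
stronglyRelativizingReals : Setoid (Level.suc 0ℓ) 0ℓ
stronglyRelativizingReals =
  On.setoid (ℕ →-setoid ℕ) (proj₁ {B = StronglyRelativizesΔ⁰₁})

{-# OPTIONS --safe #-}

-- Programs are compiled for a universal machine acting on numbers, so that the e-th open
-- subset of ℕ^ℕ × ℕ is enumerated by a computable search, uniformly in e.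
--
-- Call A tame if, whenever at every n one of two searches succeeds at A, it does so within
-- a computable time h n.  Computably dominated reals are tame, and for tame A the cutting
-- of a search at h gives the required Δ⁰₁ set.
-- Conversely, let g ≤T A, and let B collect those ⟨e , m⟩ at which A has not been found in
-- the e-th open set within g m steps.  If B is the section at A of a Δ⁰₁ set with index e,
-- then A is found at every ⟨e , m⟩, but only after g m steps; by compactness of 2^ℕ that
-- time has a computable bound.
--
-- For the cardinality, start from a nonempty Π⁰₁ class in 2^ℕ without computable members
-- and pass to subclasses.  For two given indices, either some subclass makes the two
-- searches fail forever at some n, or by compactness their time is computably bounded on
-- the whole class; so tameness can be forced.  As a nonempty class whose members agree
-- everywhere would have a computable member, the class can also be split at each stage.
-- This embeds 2^ℕ; coding graphs embeds ℕ^ℕ in 2^ℕ, and Cantor–Schröder–Bernstein applies.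

module Submission where

open import Defs
open import Axiom.ExcludedMiddle using (ExcludedMiddle)
open import Data.Empty using (⊥)
open import Data.Fin.Base using (Fin; zero; suc; toℕ)
open import Data.Fin.Properties using (toℕ-injective)
open import Data.List.Base using (List; []; _∷_; length; applyUpTo)
open import Data.List.Properties using (length-applyUpTo)
open import Data.Nat.Base using (ℕ; zero; suc; pred; _+_; _*_; _∸_; _^_; _⊔_; _≤_; _<_; _≤′_; ≤′-refl; ≤′-step; >-nonZero; z≤n; s≤s; s<s; z<s)
open import Data.Nat.Properties
open import Data.Product.Base using (Σ; ∃; ∃-syntax; _×_; _,_; proj₁; proj₂)
open import Data.Sum.Base using (_⊎_; inj₁; inj₂; [_,_]′)
open import Data.Unit.Base using (⊤; tt)
open import Data.Vec.Base using (Vec; []; _∷_; lookup; head; tail; tabulate)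
open import Data.Vec.Properties using (tabulate∘lookup)
open import Data.Vec.Relation.Binary.Pointwise.Inductive using (Pointwise; []; _∷_)
open import Function.Base using (_∘_; id; _$_)
open import Function.Bundles using (_⇔_; mk⇔; Equivalence; Bijection; Injection)
open import Level using (Level; Lift; 0ℓ; lift; lower)
open import Relation.Binary.Bundles using (Setoid)
open import Relation.Binary.Definitions using (tri<; tri≈; tri>)
open import Relation.Binary.PropositionalEquality using (_≡_; _≢_; refl; sym; trans; cong; cong₂; subst; subst₂; _→-setoid_; module ≡-Reasoning)
open import Relation.Nullary using (¬_; Dec; yes; no; contradiction)
open import Relation.Nullary.Decidable using (map′; decidable-stable)
open import Relation.Unary using (Pred; _≐_)

-- Determinism of the semantics

mutual
  deterministic : ∀ {O : Set} {φ : O → Real} {n} {p : Rec O n} {xs y z} →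
                  φ ⊢ p [ xs ]⇓ y → φ ⊢ p [ xs ]⇓ z → y ≡ z
  deterministic zero⇓ zero⇓ = refl
  deterministic suc⇓ suc⇓ = refl
  deterministic (proj⇓ i) (proj⇓ .i) = refl
  deterministic (oracle⇓ o) (oracle⇓ .o) = refl
  deterministic (comp⇓ qs⇓ p⇓) (comp⇓ qs⇓′ p⇓′) with deterministic* qs⇓ qs⇓′
  ... | refl = deterministic p⇓ p⇓′
  deterministic (prec-zero⇓ p⇓) (prec-zero⇓ p⇓′) = deterministic p⇓ p⇓′
  deterministic (prec-suc⇓ r⇓ q⇓) (prec-suc⇓ r⇓′ q⇓′) with deterministic r⇓ r⇓′
  ... | refl = deterministic q⇓ q⇓′
  deterministic {y = y} {z} (min⇓ below at) (min⇓ below′ at′) with <-cmp y z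
  ... | tri≈ _ y≡z _ = y≡z
  ... | tri< y<z _ _ = contradiction (deterministic at (proj₂ (below′ _ y<z))) λ ()
  ... | tri> _ _ z<y = contradiction (deterministic (proj₂ (below _ z<y)) at′) λ ()

  private
    deterministic* : ∀ {O : Set} {φ : O → Real} {n k} {qs : Vec (Rec O n) k} {xs ys zs} →
                     Pointwise (λ q y → φ ⊢ q [ xs ]⇓ y) qs ys →
                     Pointwise (λ q y → φ ⊢ q [ xs ]⇓ y) qs zs → ys ≡ zs
    deterministic* []         []           = refl
    deterministic* (q⇓ ∷ qs⇓) (q⇓′ ∷ qs⇓′) =
      cong₂ _∷_ (deterministic q⇓ q⇓′) (deterministic* qs⇓ qs⇓′)

least : ∀ (f : ℕ → ℕ) s → f s ≡ 0 → ∃[ m ] f m ≡ 0 × (∀ {i} → i < m → f i ≢ 0)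
least f zero    eq = 0 , eq , λ ()
least f (suc s) eq with f 0 ≟ 0
... | yes f0≡0 = 0 , f0≡0 , λ ()
... | no  f0≢0 = let m , fm≡0 , below = least (f ∘ suc) s eq in
  suc m , fm≡0 , λ { {zero} _ → f0≢0 ; {suc i} (s≤s i<m) → below i<m }

-- Computability of total functions

natrec : ℕ → (ℕ → ℕ → ℕ) → ℕ → ℕ
natrec b s zero    = b
natrec b s (suc m) = s m (natrec b s m)

if0_then_else_ : ℕ → ℕ → ℕ → ℕ
if0 zero  then a else b = a
if0 suc _ then a else b = b

dist : ℕ → ℕ → ℕ
dist a b = (a ∸ b) + (b ∸ a)

∑< ∏< : ℕ → (ℕ → ℕ) → ℕ
∑< r f = natrec 0 (λ i y → f i + y) r
∏< r f = natrec 1 (λ i y → f i * y) r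

record Computes {O : Set} (φ : O → Real) {n} (f : Vec ℕ n → ℕ) : Set where
  constructor computes
  field
    program   : Rec O n
    converges : ∀ xs → φ ⊢ program [ xs ]⇓ f xs

open Computes

module _ {O : Set} {φ : O → Real} where

  private
    C : ∀ {n} → (Vec ℕ n → ℕ) → Set
    C = Computes φ

  respects : ∀ {n} {f g : Vec ℕ n → ℕ} → (∀ xs → f xs ≡ g xs) → C f → C g
  respects f≗g (computes p p⇓) =
    computes p λ xs → subst (φ ⊢ p [ xs ]⇓_) (f≗g xs) (p⇓ xs)

  var : ∀ {n} (i : Fin n) → C (λ xs → lookup xs i)
  var i = computes (projᴿ i) λ _ → proj⇓ i

  v₀ : ∀ {n} → C {suc n} (λ xs → lookup xs zero)
  v₀ = var zero
  v₁ : ∀ {n} → C {2 + n} (λ xs → lookup xs (suc zero))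
  v₁ = var (suc zero)
  v₂ : ∀ {n} → C {3 + n} (λ xs → lookup xs (suc (suc zero)))
  v₂ = var (suc (suc zero))
  v₃ : ∀ {n} → C {4 + n} (λ xs → lookup xs (suc (suc (suc zero))))
  v₃ = var (suc (suc (suc zero)))
  v₄ : ∀ {n} → C {5 + n} (λ xs → lookup xs (suc (suc (suc (suc zero)))))
  v₄ = var (suc (suc (suc (suc zero))))

  data Args {n} : ∀ {k} → (Vec ℕ n → Vec ℕ k) → Set where
    []  : Args λ _ → []
    _∷_ : ∀ {k f} {fs : Vec ℕ n → Vec ℕ k} → C f → Args fs → Args λ xs → f xs ∷ fs xs

  private
    programs : ∀ {n k} {fs : Vec ℕ n → Vec ℕ k} → Args fs → Vec (Rec O n) k
    programs []       = []
    programs (c ∷ cs) = program c ∷ programs cs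

    programs⇓ : ∀ {n k} {fs : Vec ℕ n → Vec ℕ k} (cs : Args fs) xs →
                Pointwise (λ q y → φ ⊢ q [ xs ]⇓ y) (programs cs) (fs xs)
    programs⇓ []       xs = []
    programs⇓ (c ∷ cs) xs = converges c xs ∷ programs⇓ cs xs

  infixl 9 _⟨_⟩
  _⟨_⟩ : ∀ {n k} {g : Vec ℕ k → ℕ} {fs : Vec ℕ n → Vec ℕ k} →
         C g → Args fs → C (λ xs → g (fs xs))
  c ⟨ cs ⟩ = computes (compᴿ (program c) (programs cs))
    λ xs → comp⇓ (programs⇓ cs xs) (converges c _)

  suc-C : ∀ {n} {f : Vec ℕ n → ℕ} → C f → C (λ xs → suc (f xs))
  suc-C c = computes (compᴿ sucᴿ (program c ∷ [])) λ xs → comp⇓ (converges c xs ∷ []) suc⇓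

  oracle-C : ∀ {n} {f : Vec ℕ n → ℕ} (o : O) → C f → C (λ xs → φ o (f xs))
  oracle-C o c = computes (compᴿ (oracleᴿ o) (program c ∷ []))
    λ xs → comp⇓ (converges c xs ∷ []) (oracle⇓ o)

  const-C : ∀ {n} k → C {n} (λ _ → k)
  const-C zero    = computes zeroᴿ λ _ → zero⇓
  const-C (suc k) = suc-C (const-C k)

  private
    vars : ∀ {n k} (ρ : Fin k → Fin n) → Args λ xs → tabulate (lookup xs ∘ ρ)
    vars {k = zero}  ρ = []
    vars {k = suc k} ρ = var (ρ zero) ∷ vars (ρ ∘ suc)

  -- The whole context `xs` is handed to `precᴿ` as parameters, so the step function sees the
  -- counter, the previous value and then all of `xs`.
  natrec-C : ∀ {n} {b r : Vec ℕ n → ℕ} {s : Vec ℕ (2 + n) → ℕ} → C b → C s → C r →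
             C (λ xs → natrec (b xs) (λ i y → s (i ∷ y ∷ xs)) (r xs))
  natrec-C {n} {b} {r} {s} b-C s-C r-C = computes
    (compᴿ (precᴿ (program b-C) (program s-C)) (program r-C ∷ programs (vars id)))
    λ xs → comp⇓ (converges r-C xs ∷
                    subst (Pointwise _ _) (tabulate∘lookup xs) (programs⇓ (vars id) xs))
                 (loop xs (r xs))
    where
    loop : ∀ xs m → φ ⊢ precᴿ (program b-C) (program s-C) [ m ∷ xs ]⇓
                        natrec (b xs) (λ i y → s (i ∷ y ∷ xs)) m
    loop xs zero    = prec-zero⇓ (converges b-C xs)
    loop xs (suc m) = prec-suc⇓ (loop xs m) (converges s-C _)

  if0-C : ∀ {n} {a b c : Vec ℕ n → ℕ} → C a → C b → C c →
          C (λ xs → if0 a xs then b xs else c xs)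
  if0-C {n} {a} {b} {c} a-C b-C c-C =
    respects (λ xs → eq (a xs) (b xs) (c xs))
      (natrec-C v₀ v₃ v₂ ⟨ b-C ∷ c-C ∷ a-C ∷ [] ⟩)
    where
    eq : ∀ x y z → natrec y (λ _ _ → z) x ≡ (if0 x then y else z)
    eq zero    y z = refl
    eq (suc x) y z = refl

  pred-C : ∀ {n} {a : Vec ℕ n → ℕ} → C a → C (λ xs → pred (a xs))
  pred-C {n} {a} a-C = respects (λ xs → eq (a xs)) (natrec-C (const-C 0) v₀ a-C)
    where
    eq : ∀ m → natrec 0 (λ i _ → i) m ≡ pred m
    eq zero    = refl
    eq (suc m) = refl

  module _ {n} {a b : Vec ℕ n → ℕ} (a-C : C a) (b-C : C b) where

    +-C : C (λ xs → a xs + b xs)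
    +-C = respects (λ xs → eq (a xs) (b xs)) (natrec-C b-C (suc-C v₁) a-C)
      where
      eq : ∀ x y → natrec y (λ _ → suc) x ≡ x + y
      eq zero    y = refl
      eq (suc x) y = cong suc (eq x y)

    ∸-C : C (λ xs → a xs ∸ b xs)
    ∸-C = respects (λ xs → eq (a xs) (b xs)) (natrec-C a-C (pred-C v₁) b-C)
      where
      eq : ∀ x y → natrec x (λ _ → pred) y ≡ x ∸ y
      eq x zero    = refl
      eq x (suc y) = trans (cong pred (eq x y)) (pred[m∸n]≡m∸[1+n] x y)

  *-C : ∀ {n} {a b : Vec ℕ n → ℕ} → C a → C b → C (λ xs → a xs * b xs)
  *-C {n} {a} {b} a-C b-C = respects (λ xs → eq (a xs) (b xs))
    (natrec-C (const-C 0) (+-C v₃ v₁) v₀ ⟨ a-C ∷ b-C ∷ [] ⟩)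
    where
    eq : ∀ x y → natrec 0 (λ _ → y +_) x ≡ x * y
    eq zero    y = refl
    eq (suc x) y = cong (y +_) (eq x y)

  ^-C : ∀ {n} {a : Vec ℕ n → ℕ} k → C a → C (λ xs → k ^ a xs)
  ^-C {n} {a} k a-C = respects (λ xs → eq (a xs))
    (natrec-C (const-C 1) (*-C (const-C k) v₁) a-C)
    where
    eq : ∀ x → natrec 1 (λ _ → k *_) x ≡ k ^ x
    eq zero    = refl
    eq (suc x) = cong (k *_) (eq x)

  dist-C : ∀ {n} {a b : Vec ℕ n → ℕ} → C a → C b → C (λ xs → dist (a xs) (b xs))
  dist-C a-C b-C = +-C (∸-C a-C b-C) (∸-C b-C a-C)

  weaken-C : ∀ {n} {f : Vec ℕ n → ℕ} → C f → C {1 + n} (λ xs → f (tail xs))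
  weaken-C {f = f} f-C = respects (λ { (x ∷ xs) → cong f (tabulate∘lookup xs) }) (f-C ⟨ vars suc ⟩)

  at-C : ∀ {n} {f : Vec ℕ (1 + n) → ℕ} {a : Vec ℕ (2 + n) → ℕ} → C f → C a →
         C (λ xs → f (a xs ∷ tail (tail xs)))
  at-C {f = f} {a} f-C a-C =
    respects (λ { (i ∷ y ∷ xs) → cong (λ ys → f (a (i ∷ y ∷ xs) ∷ ys)) (tabulate∘lookup xs) })
      (f-C ⟨ a-C ∷ vars (λ i → suc (suc i)) ⟩)

  module _ {n} {f : Vec ℕ (1 + n) → ℕ} {r : Vec ℕ n → ℕ} (f-C : C f) (r-C : C r) where

    ∑-C : C (λ xs → ∑< (r xs) (λ i → f (i ∷ xs)))
    ∑-C = natrec-C (const-C 0) (+-C (at-C f-C v₀) v₁) r-C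

    ∏-C : C (λ xs → ∏< (r xs) (λ i → f (i ∷ xs)))
    ∏-C = natrec-C (const-C 1) (*-C (at-C f-C v₀) v₁) r-C

  minimum-C : ∀ {n} {f : Vec ℕ (1 + n) → ℕ} {h : Vec ℕ n → ℕ} → C f →
              (∀ xs → f (h xs ∷ xs) ≡ 0) → (∀ xs {i} → i < h xs → f (i ∷ xs) ≢ 0) → C h
  minimum-C {f = f} f-C f≡0 f≢0 = computes (minᴿ (program f-C)) λ xs →
    min⇓ (λ i i<h → pred (f (i ∷ xs)) ,
            subst (φ ⊢ program f-C [ i ∷ xs ]⇓_) (suc-pred≡ (f≢0 xs i<h)) (converges f-C (i ∷ xs)))
         (subst (φ ⊢ program f-C [ _ ]⇓_) (f≡0 xs) (converges f-C _))
    where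
    suc-pred≡ : ∀ {m} → m ≢ 0 → m ≡ suc (pred m)
    suc-pred≡ {zero}  m≢0 = contradiction refl m≢0
    suc-pred≡ {suc m} _   = refl

  module _ {n} {f : Vec ℕ (1 + n) → ℕ} (f-C : C f) {xs : Vec ℕ n} where

    minᴿ-defined⁺ : ∀ {s} → f (s ∷ xs) ≡ 0 → ∃[ y ] φ ⊢ minᴿ (program f-C) [ xs ]⇓ y
    minᴿ-defined⁺ {s} eq =
      let m , fm≡0 , below = least (λ i → f (i ∷ xs)) s eq in
      m , min⇓ (λ i i<m → positive (below i<m)) (subst (φ ⊢ program f-C [ m ∷ xs ]⇓_) fm≡0 (converges f-C (m ∷ xs)))
      where
      positive : ∀ {i} → f (i ∷ xs) ≢ 0 → ∃[ z ] φ ⊢ program f-C [ i ∷ xs ]⇓ suc z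
      positive {i} ne with f (i ∷ xs) | converges f-C (i ∷ xs)
      ... | zero  | _  = contradiction refl ne
      ... | suc z | p⇓ = z , p⇓

    minᴿ-defined⁻ : ∀ {y} → φ ⊢ minᴿ (program f-C) [ xs ]⇓ y → f (y ∷ xs) ≡ 0
    minᴿ-defined⁻ (min⇓ _ p⇓) = deterministic (converges f-C _) p⇓

-- Sequences as numbers

∑<-zero : ∀ {f : ℕ → ℕ} r → (∀ i → i < r → f i ≡ 0) → ∑< r f ≡ 0
∑<-zero zero    f≡0 = refl
∑<-zero (suc r) f≡0 = cong₂ _+_ (f≡0 r (n<1+n r)) (∑<-zero r λ i i<r → f≡0 i (m<n⇒m<1+n i<r))

∑<-single : ∀ {f : ℕ → ℕ} {r j} → j < r → (∀ i → i ≢ j → f i ≡ 0) → ∑< r f ≡ f j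
∑<-single {f} {suc r} {j} j<1+r f≡0 with m≤n⇒m<n∨m≡n (≤-pred j<1+r)
... | inj₁ j<r  = cong₂ _+_ (f≡0 r λ { refl → <-irrefl refl j<r }) (∑<-single j<r f≡0)
... | inj₂ refl = trans (cong (f j +_) (∑<-zero j λ i i<j → f≡0 i (<⇒≢ i<j))) (+-identityʳ (f j))

dist-refl : ∀ a → dist a a ≡ 0
dist-refl a = cong₂ _+_ (n∸n≡0 a) (n∸n≡0 a)

dist≡0⇒≡ : ∀ {a b} → dist a b ≡ 0 → a ≡ b
dist≡0⇒≡ {a} {b} eq =
  ≤-antisym (m∸n≡0⇒m≤n (m+n≡0⇒m≡0 (a ∸ b) eq)) (m∸n≡0⇒m≤n (m+n≡0⇒n≡0 (a ∸ b) eq))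

-- Opaque, since powers of two of numerals must not be evaluated.
opaque

  cons : ℕ → ℕ → ℕ
  cons a b = 2 ^ a * (1 + 2 * b)

  cons-def : ∀ a b → cons a b ≡ 2 ^ a * (1 + 2 * b)
  cons-def a b = refl

  -- Both components are smaller than their code and `cons` is injective, so at most one pair
  -- contributes to the double sum. At 0 the sums are empty and give the default 0.
  hd tl : ℕ → ℕ
  hd n = ∑< n λ a → ∑< n λ b → if0 dist (cons a b) n then a else 0
  tl n = ∑< n λ b → ∑< n λ a → if0 dist (cons a b) n then b else 0

  private
    odd≢even : ∀ {m n} → 1 + 2 * m ≢ 2 * n
    odd≢even {m} {suc n} eq = odd≢even {n} {m} (sym (suc-injective
      (trans eq (*-suc 2 n))))

  cons-injective : ∀ a b a′ b′ → cons a b ≡ cons a′ b′ → a ≡ a′ × b ≡ b′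
  cons-injective zero b zero b′ eq = refl , *-cancelˡ-≡ b b′ 2
    (suc-injective (trans (sym (*-identityˡ _)) (trans eq (*-identityˡ _))))
  cons-injective zero b (suc a′) b′ eq = contradiction
    (trans (sym (*-identityˡ _)) (trans eq (*-assoc 2 (2 ^ a′) _))) (odd≢even {b} {2 ^ a′ * (1 + 2 * b′)})
  cons-injective (suc a) b zero b′ eq = contradiction
    (trans (sym (*-identityˡ _)) (trans (sym eq) (*-assoc 2 (2 ^ a) _))) (odd≢even {b′} {2 ^ a * (1 + 2 * b)})
  cons-injective (suc a) b (suc a′) b′ eq =
    let a≡ , b≡ = cons-injective a b a′ b′
          (*-cancelˡ-≡ _ _ 2 (trans (sym (*-assoc 2 (2 ^ a) _)) (trans eq (*-assoc 2 (2 ^ a′) _))))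
    in cong suc a≡ , b≡

  private
    n<2^n : ∀ n → n < 2 ^ n
    n<2^n zero    = z<s
    n<2^n (suc n) = +-mono-≤ (≤-trans z<s (n<2^n n)) (≤-trans (n<2^n n) (m≤m+n _ 0))

    fst<cons : ∀ a b → a < cons a b
    fst<cons a b = ≤-trans (n<2^n a) (m≤m*n (2 ^ a) (1 + 2 * b))

    snd<cons : ∀ a b → b < cons a b
    snd<cons a b = ≤-trans (s≤s (m≤m+n b (b + 0)))
      (m≤n*m (1 + 2 * b) (2 ^ a) {{>-nonZero (≤-trans z<s (n<2^n a))}})

    same : ∀ m a → a ≡ (if0 dist m m then a else 0)
    same m a = cong (if0_then a else 0) (sym (dist-refl m))

    other : ∀ {m n} a → m ≢ n → (if0 dist m n then a else 0) ≡ 0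
    other {m} {n} a m≢n with dist m n in eq
    ... | zero  = contradiction (dist≡0⇒≡ eq) m≢n
    ... | suc _ = refl

  hd-cons : ∀ a b → hd (cons a b) ≡ a
  hd-cons a b = trans
    (∑<-single (fst<cons a b) λ i i≢a → ∑<-zero (cons a b) λ j _ → other i (i≢a ∘ proj₁ ∘ cons-injective i j a b))
    (trans (∑<-single (snd<cons a b) λ j j≢b → other a (j≢b ∘ proj₂ ∘ cons-injective a j a b))
           (sym (same (cons a b) a)))

  tl-cons : ∀ a b → tl (cons a b) ≡ b
  tl-cons a b = trans
    (∑<-single (snd<cons a b) λ j j≢b → ∑<-zero (cons a b) λ i _ → other j (j≢b ∘ proj₂ ∘ cons-injective i j a b))
    (trans (∑<-single (fst<cons a b) λ i i≢a → other b (i≢a ∘ proj₁ ∘ cons-injective i b a b))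
           (sym (same (cons a b) b)))

  tl-zero : tl 0 ≡ 0
  tl-zero = refl

  cons≢0 : ∀ a b → cons a b ≢ 0
  cons≢0 a b eq = n≮0 (subst (a <_) eq (fst<cons a b))

  cons-C : ∀ {O : Set} {φ : O → Real} {n} {f g : Vec ℕ n → ℕ} →
           Computes φ f → Computes φ g → Computes φ (λ xs → cons (f xs) (g xs))
  cons-C f-C g-C = *-C (^-C 2 f-C) (suc-C (*-C (const-C 2) g-C))

  hd-C : ∀ {O : Set} {φ : O → Real} {n} {f : Vec ℕ n → ℕ} → Computes φ f → Computes φ (λ xs → hd (f xs))
  hd-C f-C = ∑-C (∑-C (if0-C (dist-C (*-C (^-C 2 v₁) (suc-C (*-C (const-C 2) v₀))) v₂) v₁ (const-C 0)) v₁) v₀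
           ⟨ f-C ∷ [] ⟩

  tl-C : ∀ {O : Set} {φ : O → Real} {n} {f : Vec ℕ n → ℕ} → Computes φ f → Computes φ (λ xs → tl (f xs))
  tl-C f-C = ∑-C (∑-C (if0-C (dist-C (*-C (^-C 2 v₀) (suc-C (*-C (const-C 2) v₁))) v₂) v₁ (const-C 0)) v₁) v₀
           ⟨ f-C ∷ [] ⟩

code-∷ : ∀ a σ → code (a ∷ σ) ≡ cons a (code σ)
code-∷ a σ = sym (cons-def a (code σ))

drop : ℕ → ℕ → ℕ
drop i c = natrec c (λ _ → tl) i

entry : ℕ → ℕ → ℕ
entry c i = hd (drop i c)

prefix : Real → ℕ → ℕ
prefix X k = code (applyUpTo X k)

drop-tl : ∀ i c → drop (suc i) c ≡ drop i (tl c)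
drop-tl zero    c = refl
drop-tl (suc i) c = cong tl (drop-tl i c)

drop-suc-prefix : ∀ X i k → drop (suc i) (prefix X (suc k)) ≡ drop i (prefix (X ∘ suc) k)
drop-suc-prefix X i k = trans (drop-tl i _)
  (cong (drop i) (trans (cong tl (code-∷ (X 0) (applyUpTo (X ∘ suc) k))) (tl-cons _ _)))

-- Since `cons` is never 0, this and `drop-prefix≥` let the machine tell whether a query lies within
-- its finite oracle.
drop-prefix< : ∀ X {i k} → i < k → ∃[ r ] drop i (prefix X k) ≡ cons (X i) r
drop-prefix< X {zero}  {suc k} _         = _ , code-∷ (X 0) (applyUpTo (X ∘ suc) k)
drop-prefix< X {suc i} {suc k} (s≤s i<k) =
  let r , eq = drop-prefix< (X ∘ suc) i<k in r , trans (drop-suc-prefix X i k) eq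

drop-zero : ∀ i → drop i 0 ≡ 0
drop-zero zero    = refl
drop-zero (suc i) = trans (cong tl (drop-zero i)) tl-zero

drop-prefix≥ : ∀ X {i k} → k ≤ i → drop i (prefix X k) ≡ 0
drop-prefix≥ X {i} {zero} _ = drop-zero i
drop-prefix≥ X {suc i} {suc k} (s≤s k≤i) =
  trans (drop-suc-prefix X i k) (drop-prefix≥ (X ∘ suc) k≤i)

entry-prefix : ∀ X {i k} → i < k → entry (prefix X k) i ≡ X i
entry-prefix X i<k with _ , eq ← drop-prefix< X i<k = trans (cong hd eq) (hd-cons _ _)

-- A universal machine

-- Instructions act on one current value, in which an argument vector is stored as an iterated
-- `cons`. The rest of the computation is a stack of instructions, so a state can be coded by a
-- number.
data Instr : Set where
  zeroI sucI hdI tlI oracleI : Instr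
  seqI pairI precI           : Instr → Instr → Instr
  minI                       : Instr → Instr
  -- The remaining instructions occur only in control stacks; they hold
  -- intermediate values.
  pair₂I : Instr → ℕ → Instr
  pair₃I : ℕ → Instr
  loopI  : Instr → (i r xs : ℕ) → Instr
  testI  : Instr → (i xs : ℕ) → Instr

State : Set
State = ℕ × List Instr

-- A query beyond the end of the finite oracle c leaves the state unchanged forever.
step : ℕ → State → State
step c (v , [])                      = v , []
step c (v , zeroI ∷ K)               = 0 , K
step c (v , sucI ∷ K)                = suc (hd v) , K
step c (v , hdI ∷ K)                 = hd v , K
step c (v , tlI ∷ K)                 = tl v , K
step c (v , oracleI ∷ K) with drop (hd v) c
... | zero                           = v , oracleI ∷ K
... | c′@(suc _)                     = hd c′ , K
step c (v , seqI f g ∷ K)            = v , f ∷ g ∷ K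
step c (v , pairI f g ∷ K)           = v , f ∷ pair₂I g v ∷ K
step c (v , precI f g ∷ K)           = tl v , f ∷ loopI g 0 (hd v) (tl v) ∷ K
step c (v , minI f ∷ K)              = cons 0 v , f ∷ testI f 0 v ∷ K
step c (v , pair₂I g w ∷ K)          = w , g ∷ pair₃I v ∷ K
step c (v , pair₃I w ∷ K)            = cons w v , K
step c (v , loopI g i zero xs ∷ K)   = v , K
step c (v , loopI g i (suc r) xs ∷ K) = cons i (cons v xs) , g ∷ loopI g (suc i) r xs ∷ K
step c (zero , testI f i xs ∷ K)     = i , K
step c (suc _ , testI f i xs ∷ K)    = cons (suc i) xs , f ∷ testI f (suc i) xs ∷ K

run : ℕ → ℕ → State → State
run c zero    st = st
run c (suc s) st = run c s (step c st)

run-suc : ∀ c s st → run c (suc s) st ≡ step c (run c s st)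
run-suc c zero    st = refl
run-suc c (suc s) st = run-suc c s (step c st)

⌜_⌝ᴵ : Instr → ℕ
⌜ zeroI ⌝ᴵ          = cons 0 0
⌜ sucI ⌝ᴵ           = cons 1 0
⌜ hdI ⌝ᴵ            = cons 2 0
⌜ tlI ⌝ᴵ            = cons 3 0
⌜ oracleI ⌝ᴵ        = cons 4 0
⌜ seqI f g ⌝ᴵ       = cons 5 (cons ⌜ f ⌝ᴵ ⌜ g ⌝ᴵ)
⌜ pairI f g ⌝ᴵ      = cons 6 (cons ⌜ f ⌝ᴵ ⌜ g ⌝ᴵ)
⌜ precI f g ⌝ᴵ      = cons 7 (cons ⌜ f ⌝ᴵ ⌜ g ⌝ᴵ)
⌜ minI f ⌝ᴵ         = cons 8 ⌜ f ⌝ᴵ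
⌜ pair₂I g w ⌝ᴵ     = cons 9 (cons ⌜ g ⌝ᴵ w)
⌜ pair₃I w ⌝ᴵ       = cons 10 w
⌜ loopI g i r xs ⌝ᴵ = cons 11 (cons ⌜ g ⌝ᴵ (cons i (cons r xs)))
⌜ testI f i xs ⌝ᴵ   = cons 12 (cons ⌜ f ⌝ᴵ (cons i xs))

⌜_⌝ᴷ : List Instr → ℕ
⌜ [] ⌝ᴷ    = 0
⌜ I ∷ K ⌝ᴷ = cons ⌜ I ⌝ᴵ ⌜ K ⌝ᴷ

⌜_⌝ : State → ℕ
⌜ v , K ⌝ = cons v ⌜ K ⌝ᴷ

-- Here `t` is the tag and `d` the data of the top instruction. The test `t ∸ j` is reached only
-- when `t` is at least `j`, so it singles out `t ≡ j`; the last alternative serves tag 12.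
branch : (c v t d K : ℕ) → ℕ
branch c v t d K =
  if0 t       then cons 0 K else
  if0 t ∸ 1   then cons (suc (hd v)) K else
  if0 t ∸ 2   then cons (hd v) K else
  if0 t ∸ 3   then cons (tl v) K else
  if0 t ∸ 4   then (if0 drop (hd v) c then cons v (cons (cons 4 0) K)
                                      else cons (hd (drop (hd v) c)) K) else
  if0 t ∸ 5   then cons v (cons (hd d) (cons (tl d) K)) else
  if0 t ∸ 6   then cons v (cons (hd d) (cons (cons 9 (cons (tl d) v)) K)) else
  if0 t ∸ 7   then cons (tl v) (cons (hd d) (cons (cons 11 (cons (tl d) (cons 0 (cons (hd v) (tl v))))) K)) else
  if0 t ∸ 8   then cons (cons 0 v) (cons d (cons (cons 12 (cons d (cons 0 v))) K)) else
  if0 t ∸ 9   then cons (tl d) (cons (hd d) (cons (cons 10 v) K)) else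
  if0 t ∸ 10  then cons (cons d v) K else
  if0 t ∸ 11  then (if0 hd (tl (tl d)) then cons v K else
    cons (cons (hd (tl d)) (cons v (tl (tl (tl d)))))
         (cons (hd d) (cons (cons 11 (cons (hd d)
           (cons (suc (hd (tl d))) (cons (pred (hd (tl (tl d)))) (tl (tl (tl d))))))) K))) else
  (if0 v then cons (hd (tl d)) K else
    cons (cons (suc (hd (tl d))) (tl (tl d)))
         (cons (hd d) (cons (cons 12 (cons (hd d) (cons (suc (hd (tl d))) (tl (tl d))))) K)))

if0-≡0 : ∀ {m} a b → m ≡ 0 → (if0 m then a else b) ≡ a
if0-≡0 a b refl = refl

private
  if0-≢0 : ∀ {m} a b → m ≢ 0 → (if0 m then a else b) ≡ b
  if0-≢0 {zero}  a b m≢0 = contradiction refl m≢0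
  if0-≢0 {suc m} a b _   = refl

-- Opaque, to keep the large case distinction out of normal forms.
opaque

  stepᴺ : ℕ → ℕ → ℕ
  stepᴺ c st = if0 tl st then st else
    branch c (hd st) (hd (hd (tl st))) (tl (hd (tl st))) (tl (tl st))

  stepᴺ-halted : ∀ c st → tl st ≡ 0 → stepᴺ c st ≡ st
  stepᴺ-halted c st = if0-≡0 _ _

  stepᴺ-branch : ∀ c v t d K → stepᴺ c (cons v (cons (cons t d) K)) ≡ branch c v t d K
  stepᴺ-branch c v t d K
    rewrite tl-cons v (cons (cons t d) K) | hd-cons v (cons (cons t d) K)
          | hd-cons (cons t d) K | tl-cons (cons t d) K | hd-cons t d | tl-cons t d
    = if0-≢0 _ _ (cons≢0 (cons t d) K)

private
  branch-step : ∀ c v I K → stepᴺ c ⌜ v , I ∷ K ⌝ ≡ ⌜ step c (v , I ∷ K) ⌝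
  branch-step c v zeroI K = stepᴺ-branch c v 0 _ _
  branch-step c v sucI K = stepᴺ-branch c v 1 _ _
  branch-step c v hdI K = stepᴺ-branch c v 2 _ _
  branch-step c v tlI K = stepᴺ-branch c v 3 _ _
  branch-step c v oracleI K = trans (stepᴺ-branch c v 4 _ _) eq
    where
    eq : branch c v 4 0 ⌜ K ⌝ᴷ ≡ ⌜ step c (v , oracleI ∷ K) ⌝
    eq with drop (hd v) c
    ... | zero  = refl
    ... | suc _ = refl
  branch-step c v (seqI f g) K = trans (stepᴺ-branch c v 5 _ _) eq
    where
    eq : branch c v 5 (cons ⌜ f ⌝ᴵ ⌜ g ⌝ᴵ) ⌜ K ⌝ᴷ ≡ ⌜ step c (v , seqI f g ∷ K) ⌝
    eq rewrite hd-cons ⌜ f ⌝ᴵ ⌜ g ⌝ᴵ | tl-cons ⌜ f ⌝ᴵ ⌜ g ⌝ᴵ = refl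
  branch-step c v (pairI f g) K = trans (stepᴺ-branch c v 6 _ _) eq
    where
    eq : branch c v 6 (cons ⌜ f ⌝ᴵ ⌜ g ⌝ᴵ) ⌜ K ⌝ᴷ ≡ ⌜ step c (v , pairI f g ∷ K) ⌝
    eq rewrite hd-cons ⌜ f ⌝ᴵ ⌜ g ⌝ᴵ | tl-cons ⌜ f ⌝ᴵ ⌜ g ⌝ᴵ = refl
  branch-step c v (precI f g) K = trans (stepᴺ-branch c v 7 _ _) eq
    where
    eq : branch c v 7 (cons ⌜ f ⌝ᴵ ⌜ g ⌝ᴵ) ⌜ K ⌝ᴷ ≡ ⌜ step c (v , precI f g ∷ K) ⌝
    eq rewrite hd-cons ⌜ f ⌝ᴵ ⌜ g ⌝ᴵ | tl-cons ⌜ f ⌝ᴵ ⌜ g ⌝ᴵ = refl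
  branch-step c v (minI f) K = stepᴺ-branch c v 8 _ _
  branch-step c v (pair₂I g w) K = trans (stepᴺ-branch c v 9 _ _) eq
    where
    eq : branch c v 9 (cons ⌜ g ⌝ᴵ w) ⌜ K ⌝ᴷ ≡ ⌜ step c (v , pair₂I g w ∷ K) ⌝
    eq rewrite hd-cons ⌜ g ⌝ᴵ w | tl-cons ⌜ g ⌝ᴵ w = refl
  branch-step c v (pair₃I w) K = stepᴺ-branch c v 10 _ _
  branch-step c v (loopI g i r xs) K = trans (stepᴺ-branch c v 11 _ _) (eq r)
    where
    eq : ∀ r → branch c v 11 (cons ⌜ g ⌝ᴵ (cons i (cons r xs))) ⌜ K ⌝ᴷ ≡ ⌜ step c (v , loopI g i r xs ∷ K) ⌝
    eq r rewrite hd-cons ⌜ g ⌝ᴵ (cons i (cons r xs)) | tl-cons ⌜ g ⌝ᴵ (cons i (cons r xs))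
               | hd-cons i (cons r xs) | tl-cons i (cons r xs) | hd-cons r xs | tl-cons r xs with r
    ... | zero  = refl
    ... | suc _ = refl
  branch-step c v (testI f i xs) K = trans (stepᴺ-branch c v 12 _ _) (eq v)
    where
    eq : ∀ v → branch c v 12 (cons ⌜ f ⌝ᴵ (cons i xs)) ⌜ K ⌝ᴷ ≡ ⌜ step c (v , testI f i xs ∷ K) ⌝
    eq v rewrite hd-cons ⌜ f ⌝ᴵ (cons i xs) | tl-cons ⌜ f ⌝ᴵ (cons i xs)
               | hd-cons i xs | tl-cons i xs with v
    ... | zero  = refl
    ... | suc _ = refl

stepᴺ-step : ∀ c st → stepᴺ c ⌜ st ⌝ ≡ ⌜ step c st ⌝
stepᴺ-step c (v , I ∷ K) = branch-step c v I K
stepᴺ-step c (v , [])    = stepᴺ-halted c (cons v 0) (tl-cons v 0)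

runᴺ : (c I v s : ℕ) → ℕ
runᴺ c I v s = natrec (cons v (cons I 0)) (λ _ → stepᴺ c) s

runᴺ-run : ∀ c I v s → runᴺ c ⌜ I ⌝ᴵ v s ≡ ⌜ run c s (v , I ∷ []) ⌝
runᴺ-run c I v zero    = refl
runᴺ-run c I v (suc s) = trans (cong (stepᴺ c) (runᴺ-run c I v s))
  (trans (stepᴺ-step c (run c s (v , I ∷ []))) (cong ⌜_⌝ (sym (run-suc c s (v , I ∷ [])))))

module _ {O : Set} {φ : O → Real} where

  private
    C : ∀ {n} → (Vec ℕ n → ℕ) → Set
    C = Computes φ

  drop-C : ∀ {n} {i c : Vec ℕ n → ℕ} → C i → C c → C (λ xs → drop (i xs) (c xs))
  drop-C i-C c-C = natrec-C c-C (tl-C v₁) i-C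

  private
    branch-C : C {5} (λ xs → branch (lookup xs zero) (lookup xs (suc zero)) (lookup xs (suc (suc zero)))
                 (lookup xs (suc (suc (suc zero)))) (lookup xs (suc (suc (suc (suc zero))))))
    branch-C =
      if0-C t (cons-C (const-C 0) K) $
      if0-C (∸-C t (const-C 1)) (cons-C (suc-C (hd-C v)) K) $
      if0-C (∸-C t (const-C 2)) (cons-C (hd-C v) K) $
      if0-C (∸-C t (const-C 3)) (cons-C (tl-C v) K) $
      if0-C (∸-C t (const-C 4))
        (if0-C (drop-C (hd-C v) c) (cons-C v (cons-C (cons-C (const-C 4) (const-C 0)) K))
          (cons-C (hd-C (drop-C (hd-C v) c)) K)) $
      if0-C (∸-C t (const-C 5)) (cons-C v (cons-C (hd-C d) (cons-C (tl-C d) K))) $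
      if0-C (∸-C t (const-C 6)) (cons-C v (cons-C (hd-C d) (cons-C (cons-C (const-C 9) (cons-C (tl-C d) v)) K))) $
      if0-C (∸-C t (const-C 7)) (cons-C (tl-C v) (cons-C (hd-C d)
        (cons-C (cons-C (const-C 11) (cons-C (tl-C d) (cons-C (const-C 0) (cons-C (hd-C v) (tl-C v))))) K))) $
      if0-C (∸-C t (const-C 8)) (cons-C (cons-C (const-C 0) v) (cons-C d
        (cons-C (cons-C (const-C 12) (cons-C d (cons-C (const-C 0) v))) K))) $
      if0-C (∸-C t (const-C 9)) (cons-C (tl-C d) (cons-C (hd-C d) (cons-C (cons-C (const-C 10) v) K))) $
      if0-C (∸-C t (const-C 10)) (cons-C (cons-C d v) K) $
      if0-C (∸-C t (const-C 11)) (if0-C (hd-C (tl-C (tl-C d))) (cons-C v K)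
        (cons-C (cons-C (hd-C (tl-C d)) (cons-C v (tl-C (tl-C (tl-C d)))))
          (cons-C (hd-C d) (cons-C (cons-C (const-C 11) (cons-C (hd-C d)
            (cons-C (suc-C (hd-C (tl-C d))) (cons-C (pred-C (hd-C (tl-C (tl-C d)))) (tl-C (tl-C (tl-C d)))))))
            K)))) $
      if0-C v (cons-C (hd-C (tl-C d)) K)
        (cons-C (cons-C (suc-C (hd-C (tl-C d))) (tl-C (tl-C d)))
          (cons-C (hd-C d) (cons-C (cons-C (const-C 12) (cons-C (hd-C d)
            (cons-C (suc-C (hd-C (tl-C d))) (tl-C (tl-C d))))) K)))
      where
      c = v₀
      v = v₁
      t = v₂
      d = v₃
      K = v₄

  opaque
    unfolding stepᴺ

    stepᴺ-C : ∀ {n} {c st : Vec ℕ n → ℕ} → C c → C st → C (λ xs → stepᴺ (c xs) (st xs))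
    stepᴺ-C c-C st-C = if0-C (tl-C st-C) st-C
      (branch-C ⟨ c-C ∷ hd-C st-C ∷ hd-C (hd-C (tl-C st-C)) ∷ tl-C (hd-C (tl-C st-C)) ∷ tl-C (tl-C st-C) ∷ [] ⟩)

  runᴺ-C : ∀ {n} {c I v s : Vec ℕ n → ℕ} → C c → C I → C v → C s →
           C (λ xs → runᴺ (c xs) (I xs) (v xs) (s xs))
  runᴺ-C c-C I-C v-C s-C = natrec-C (cons-C v₂ (cons-C v₁ (const-C 0))) (stepᴺ-C v₂ v₁) v₃
    ⟨ c-C ∷ I-C ∷ v-C ∷ s-C ∷ [] ⟩

-- Compilation

⌜_⌝ⱽ : ∀ {n} → Vec ℕ n → ℕ
⌜ [] ⌝ⱽ     = 0
⌜ x ∷ xs ⌝ⱽ = cons x ⌜ xs ⌝ⱽ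

projI : ∀ {n} → Fin n → Instr
projI zero    = hdI
projI (suc i) = seqI tlI (projI i)

mutual
  -- Oracle names are forgotten: the machine has one oracle, so correctness presupposes that all
  -- names denote the same real. For `O = ⊥` this is vacuous.
  compile : ∀ {O n} → Rec O n → Instr
  compile zeroᴿ        = zeroI
  compile sucᴿ         = sucI
  compile (projᴿ i)    = projI i
  compile (oracleᴿ o)  = oracleI
  compile (compᴿ p qs) = seqI (compile* qs) (compile p)
  compile (precᴿ p q)  = precI (compile p) (compile q)
  compile (minᴿ p)     = minI (compile p)

  compile* : ∀ {O n k} → Vec (Rec O n) k → Instr
  compile* []       = zeroI
  compile* (q ∷ qs) = pairI (compile q) (compile* qs)

-- Completeness of compiled programs

Eventually : (ℕ → Set) → Set
Eventually P = ∃[ k₀ ] ∀ {k} → k₀ ≤ k → P k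

always : ∀ {P : ℕ → Set} → (∀ {k} → P k) → Eventually P
always p = 0 , λ _ → p

weaken : ∀ {P Q : ℕ → Set} → (∀ {k} → P k → Q k) → Eventually P → Eventually Q
weaken f (k₀ , p) = k₀ , λ le → f (p le)

both : ∀ {P Q R : ℕ → Set} → (∀ {k} → P k → Q k → R k) → Eventually P → Eventually Q → Eventually R
both f (k₁ , p) (k₂ , q) =
  k₁ ⊔ k₂ , λ le → f (p (≤-trans (m≤m⊔n k₁ k₂) le)) (q (≤-trans (m≤n⊔m k₁ k₂) le))

all-below : ∀ {P : ℕ → ℕ → Set} m → (∀ i → i < m → Eventually (P i)) →
            Eventually λ k → ∀ i → i < m → P i k
all-below         zero    _ = always λ _ ()
all-below {P = P} (suc m) p = both merge (all-below m λ i i<m → p i (m<n⇒m<1+n i<m)) (p m (n<1+n m))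
  where
  merge : ∀ {k} → (∀ i → i < m → P i k) → P m k → ∀ i → i < suc m → P i k
  merge below at i i<1+m with m≤n⇒m<n∨m≡n (≤-pred i<1+m)
  ... | inj₁ i<m  = below i i<m
  ... | inj₂ refl = at

infix 3 _⊢_⇝_
_⊢_⇝_ : ℕ → State → State → Set
c ⊢ st ⇝ st′ = ∃[ s ] run c s st ≡ st′

private
  run-+ : ∀ c s t st → run c (s + t) st ≡ run c t (run c s st)
  run-+ c zero    t st = refl
  run-+ c (suc s) t st = run-+ c s t (step c st)

  infixr 5 _◅_ _◅◅_
  _◅◅_ : ∀ {c st st′ st″} → c ⊢ st ⇝ st′ → c ⊢ st′ ⇝ st″ → c ⊢ st ⇝ st″
  _◅◅_ {c} {st} (s , refl) (t , refl) = s + t , run-+ c s t st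

  _◅_ : ∀ {c st st′ st″} → step c st ≡ st′ → c ⊢ st′ ⇝ st″ → c ⊢ st ⇝ st″
  refl ◅ (s , refl) = suc s , refl

  stop : ∀ {c st st′} → st ≡ st′ → c ⊢ st ⇝ st′
  stop refl = 0 , refl

Evaluates : ℕ → ℕ → Instr → ℕ → Set
Evaluates c v I y = ∀ K → c ⊢ v , I ∷ K ⇝ y , K

private
  proj-evaluates : ∀ {c n} (xs : Vec ℕ n) i → Evaluates c ⌜ xs ⌝ⱽ (projI i) (lookup xs i)
  proj-evaluates (x ∷ xs) zero    K = refl ◅ stop (cong (_, K) (hd-cons x _))
  proj-evaluates (x ∷ xs) (suc i) K =
    refl ◅ refl ◅ stop (cong (_, projI i ∷ K) (tl-cons x _)) ◅◅ proj-evaluates xs i K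

  oracle-step : ∀ {c v a r K} → drop (hd v) c ≡ cons a r → step c (v , oracleI ∷ K) ≡ (a , K)
  oracle-step {c} {v} {a} {r} {K} eq with drop (hd v) c
  ... | zero  = contradiction (sym eq) (cons≢0 a r)
  ... | suc _ = cong (_, K) (trans (cong hd eq) (hd-cons a r))

prec-start : ∀ c m xs {f g K} →
             step c (cons m xs , precI f g ∷ K) ≡ (xs , f ∷ loopI g 0 m xs ∷ K)
prec-start c m xs rewrite hd-cons m xs | tl-cons m xs = refl

module _ {O : Set} {φ : O → Real} (c : ℕ → ℕ)
         (query : ∀ o x → Eventually λ k → ∃[ r ] drop x (c k) ≡ cons (φ o x) r) where

  mutual
    -- A convergent computation makes finitely many queries, so the approximation `c k` answers all
    -- of them once `k` is large; the bounds from subcomputations are merged by maximum.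
    evaluates : ∀ {n} {p : Rec O n} {xs y} → φ ⊢ p [ xs ]⇓ y →
                Eventually λ k → Evaluates (c k) ⌜ xs ⌝ⱽ (compile p) y
    evaluates zero⇓ = always λ K → refl ◅ stop refl
    evaluates (suc⇓ {x}) = always λ K → refl ◅ stop (cong (λ v → suc v , K) (hd-cons x 0))
    evaluates {xs = xs} (proj⇓ i) = always (proj-evaluates xs i)
    evaluates (oracle⇓ o {x}) = weaken
      (λ {k} (r , eq) K → oracle-step (trans (cong (λ i → drop i (c k)) (hd-cons x 0)) eq) ◅ stop refl)
      (query o x)
    evaluates (comp⇓ qs⇓ p⇓) =
      both (λ qs p K → refl ◅ qs _ ◅◅ p K) (evaluates* qs⇓) (evaluates p⇓)
    evaluates {xs = .0 ∷ xs} r⇓@(prec-zero⇓ _) =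
      weaken (λ {k} l K → prec-start (c k) 0 ⌜ xs ⌝ⱽ ◅ l 0 0 refl K ◅◅ refl ◅ stop refl) (evaluates-prec r⇓)
    evaluates {xs = suc m ∷ xs} r⇓@(prec-suc⇓ _ _) =
      weaken (λ {k} l K → prec-start (c k) (suc m) ⌜ xs ⌝ⱽ ◅ l (suc m) 0 (+-identityʳ (suc m)) K ◅◅ refl ◅ stop refl) (evaluates-prec r⇓)
    evaluates {xs = xs} (min⇓ {p = p} {y = y} below at) =
      both (λ {k} b a K → refl ◅ test k b a K y 0 (+-identityʳ y))
        (all-below y λ i i<y → let z , p⇓ = below i i<y in weaken (λ e → z , e) (evaluates p⇓))
        (evaluates at)
      where
      test : ∀ k → (∀ i → i < y → ∃[ z ] Evaluates (c k) ⌜ i ∷ xs ⌝ⱽ (compile p) (suc z)) →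
             Evaluates (c k) ⌜ y ∷ xs ⌝ⱽ (compile p) 0 →
             ∀ K d i → d + i ≡ y →
             c k ⊢ cons i ⌜ xs ⌝ⱽ , compile p ∷ testI (compile p) i ⌜ xs ⌝ⱽ ∷ K ⇝ y , K
      test k b a K zero    i refl = a _ ◅◅ refl ◅ stop refl
      test k b a K (suc d) i eq   =
        proj₂ (b i (subst (i <_) eq (s≤s (m≤n+m i d)))) _
          ◅◅ refl ◅ test k b a K d (suc i) (trans (+-suc d i) eq)

    private
      -- Loop invariant: of `t` rounds, `m` are done and `r` remain. Quantifying over `t` and `r`
      -- lets the induction on `m` keep the same starting stack.
      evaluates-prec : ∀ {n} {p : Rec O n} {q m xs y} → φ ⊢ precᴿ p q [ m ∷ xs ]⇓ y →
                       Eventually λ k → ∀ t r → m + r ≡ t → ∀ K →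
                       c k ⊢ ⌜ xs ⌝ⱽ , compile p ∷ loopI (compile q) 0 t ⌜ xs ⌝ⱽ ∷ K
                                  ⇝ y , loopI (compile q) m r ⌜ xs ⌝ⱽ ∷ K
      evaluates-prec (prec-zero⇓ p⇓) = weaken (λ { e t .t refl K → e _ }) (evaluates p⇓)
      evaluates-prec (prec-suc⇓ {m = m} r⇓ q⇓) =
        both (λ l e t r eq K → l t (suc r) (trans (+-suc m r) eq) K ◅◅ refl ◅ e _)
             (evaluates-prec r⇓) (evaluates q⇓)

      evaluates* : ∀ {n k} {qs : Vec (Rec O n) k} {xs ys} → Pointwise (λ q y → φ ⊢ q [ xs ]⇓ y) qs ys →
                   Eventually λ k → Evaluates (c k) ⌜ xs ⌝ⱽ (compile* qs) ⌜ ys ⌝ⱽ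
      evaluates* []         = always λ K → refl ◅ stop refl
      evaluates* (q⇓ ∷ qs⇓) =
        both (λ q qs K → refl ◅ q _ ◅◅ refl ◅ qs _ ◅◅ refl ◅ stop refl) (evaluates q⇓) (evaluates* qs⇓)

-- Soundness of compiled programs

Halts : ℕ → ℕ → State → Set
Halts c s st = proj₂ (run c s st) ≡ []

module _ {O : Set} {φ : O → Real} {X : Real} (φ≗X : ∀ o i → φ o i ≡ X i) (k : ℕ) where

  private
    c : ℕ
    c = prefix X k

    ReturnsBefore : ℕ → (ℕ → Set) → List Instr → Set
    ReturnsBefore s P K = ∃[ y ] P y × ∃[ s′ ] s′ < s × Halts c s′ (y , K)

    -- A halting run must finish `I` and hand a value satisfying `P` to the continuation `K`. The
    -- strict drop in remaining steps is what bounds unbounded minimization in `test-sound`.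
    Sound : ℕ → Instr → (ℕ → Set) → Set
    Sound v I P = ∀ s K → Halts c s (v , I ∷ K) → ReturnsBefore s P K

    later : ∀ {s t P Q K} → s ≤ t → (∀ {y} → P y → Q y) → ReturnsBefore s P K → ReturnsBefore t Q K
    later s≤t f (y , p , s′ , s′<s , h) = y , f p , s′ , ≤-trans s′<s s≤t , h

    rewind : ∀ {st st′} s → st ≡ st′ → Halts c s st → Halts c s st′
    rewind s eq = subst (Halts c s) eq

    proj-sound : ∀ {n} (xs : Vec ℕ n) i → Sound ⌜ xs ⌝ⱽ (projI i) (_≡ lookup xs i)
    proj-sound (x ∷ xs) zero    (suc s) K h = _ , hd-cons x _ , s , ≤-refl , h
    proj-sound (x ∷ xs) (suc i) (suc (suc s)) K h = later (m≤n+m s 2) id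
      (proj-sound xs i s K (rewind s (cong (_, projI i ∷ K) (tl-cons x _)) h))

    oracle-sound : ∀ x → Sound (cons x 0) oracleI (_≡ X x)
    oracle-sound x (suc s) K h with drop (hd (cons x 0)) c in eq
    -- An unanswered query reproduces the same state with one step fewer to go, so it cannot lead to
    -- halting.
    ... | zero  = later (m≤n+m s 1) id (oracle-sound x s K h)
    ... | c′@(suc _) = hd c′ , hd≡ , s , ≤-refl , h
      where
      hd≡ : hd c′ ≡ X x
      hd≡ with <-cmp x k
      ... | tri< x<k _ _ = let r , eq′ = drop-prefix< X x<k in
        trans (cong hd (trans (sym eq) (trans (cong (λ i → drop i c) (hd-cons x 0)) eq′))) (hd-cons _ r)
      ... | tri≈ _ refl _ = contradiction
        (trans (sym eq) (trans (cong (λ i → drop i c) (hd-cons x 0)) (drop-prefix≥ X {x} ≤-refl))) λ ()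
      ... | tri> _ _ k<x = contradiction
        (trans (sym eq) (trans (cong (λ i → drop i c) (hd-cons x 0)) (drop-prefix≥ X {x} (<⇒≤ k<x)))) λ ()

    module _ {n} {p : Rec O n} {q : Rec O (2 + n)} {xs : Vec ℕ n}
             (q-sound : ∀ ys → Sound ⌜ ys ⌝ⱽ (compile q) (φ ⊢ q [ ys ]⇓_)) where

      loop-sound : ∀ r {i y t} → i + r ≡ t → φ ⊢ precᴿ p q [ i ∷ xs ]⇓ y →
                   Sound y (loopI (compile q) i r ⌜ xs ⌝ⱽ) (φ ⊢ precᴿ p q [ t ∷ xs ]⇓_)
      loop-sound zero    {i} eq i⇓ (suc s) K h = _ ,
        subst (λ t → φ ⊢ precᴿ p q [ t ∷ xs ]⇓ _) (trans (sym (+-identityʳ i)) eq) i⇓ , s , ≤-refl , h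
      loop-sound (suc r) {i} {y} eq i⇓ (suc s) K h =
        let z , q⇓ , s′ , s′<s , h′ = q-sound (i ∷ y ∷ xs) s _ h in
        later (m≤n⇒m≤1+n (<⇒≤ s′<s)) id
          (loop-sound r (trans (sym (+-suc i r)) eq) (prec-suc⇓ i⇓ q⇓) s′ K h′)

    module _ {n} {p : Rec O (1 + n)} {xs : Vec ℕ n}
             (p-sound : ∀ ys → Sound ⌜ ys ⌝ⱽ (compile p) (φ ⊢ p [ ys ]⇓_)) where

      -- The candidate `i` grows without a bound known in advance; only the number of remaining
      -- steps decreases, so the recursion is on `fuel`.
      test-sound : ∀ fuel s {i K} → s < fuel → (∀ j → j < i → ∃[ z ] φ ⊢ p [ j ∷ xs ]⇓ suc z) →
                   Halts c s (⌜ i ∷ xs ⌝ⱽ , compile p ∷ testI (compile p) i ⌜ xs ⌝ⱽ ∷ K) →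
                   ReturnsBefore s (φ ⊢ minᴿ p [ xs ]⇓_) K
      test-sound (suc fuel) s {i} {K} (s≤s s≤fuel) below h with p-sound (i ∷ xs) s _ h
      ... | zero  , p⇓ , suc s′ , s′<s , h′ = i , min⇓ below p⇓ , s′ , <-trans ≤-refl s′<s , h′
      ... | suc z , p⇓ , suc s′ , s′<s , h′ = later (<⇒≤ (<-trans ≤-refl s′<s)) id
        (test-sound fuel s′ (≤-trans (<-trans ≤-refl s′<s) s≤fuel) below′ h′)
        where
        below′ : ∀ j → j < suc i → ∃[ z ] φ ⊢ p [ j ∷ xs ]⇓ suc z
        below′ j j<1+i with m≤n⇒m<n∨m≡n (≤-pred j<1+i)
        ... | inj₁ j<i  = below j j<i
        ... | inj₂ refl = z , p⇓

  mutual
    sound : ∀ {n} (p : Rec O n) xs → Sound ⌜ xs ⌝ⱽ (compile p) (φ ⊢ p [ xs ]⇓_)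
    sound zeroᴿ xs (suc s) K h = 0 , zero⇓ , s , ≤-refl , h
    sound sucᴿ (x ∷ []) (suc s) K h =
      _ , subst (φ ⊢ sucᴿ [ x ∷ [] ]⇓_) (cong suc (sym (hd-cons x 0))) suc⇓ , s , ≤-refl , h
    sound (projᴿ i) xs s K h = later ≤-refl (λ { refl → proj⇓ i }) (proj-sound xs i s K h)
    sound (oracleᴿ o) (x ∷ []) s K h =
      later ≤-refl (λ { refl → subst (φ ⊢ _ [ _ ]⇓_) (φ≗X o x) (oracle⇓ o) }) (oracle-sound x s K h)
    sound (compᴿ p qs) xs (suc s) K h with sound* qs xs s _ h
    ... | _ , (ys , refl , qs⇓) , s′ , s′<s , h′ =
      later (m≤n⇒m≤1+n (<⇒≤ s′<s)) (comp⇓ qs⇓) (sound p ys s′ K h′)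
    sound (precᴿ p q) (m ∷ xs) (suc s) K h =
      let y , p⇓ , s′ , s′<s , h′ = sound p xs s _ (rewind s (prec-start c m ⌜ xs ⌝ⱽ) h) in
      later (m≤n⇒m≤1+n (<⇒≤ s′<s)) id (loop-sound (sound q) m refl (prec-zero⇓ p⇓) s′ K h′)
    sound (minᴿ p) xs (suc s) K h =
      later (m≤n+m s 1) id (test-sound (sound p) (suc s) s ≤-refl (λ _ ()) h)

    private
      sound* : ∀ {n m} (qs : Vec (Rec O n) m) xs →
               Sound ⌜ xs ⌝ⱽ (compile* qs)
                 (λ y → Σ (Vec ℕ m) λ ys → y ≡ ⌜ ys ⌝ⱽ × Pointwise (λ q y → φ ⊢ q [ xs ]⇓ y) qs ys)
      sound* []       xs (suc s) K h = _ , ([] , refl , []) , s , ≤-refl , h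
      sound* (q ∷ qs) xs (suc s) K h with sound q xs s _ h
      ... | y , q⇓ , suc s₁ , s₁<s , h₁ with sound* qs xs s₁ _ h₁
      ... | _ , (ys , refl , qs⇓) , suc s₂ , s₂<s₁ , h₂ =
        _ , (y ∷ ys , refl , q⇓ ∷ qs⇓) , s₂ ,
        m<n⇒m<1+n (<-trans (<-trans ≤-refl s₂<s₁) (<-trans ≤-refl s₁<s)) , h₂

-- Halting within a given number of steps

pending : (c e v s : ℕ) → ℕ
pending c e v s = tl (runᴺ c e v s)

pending-C : ∀ {O : Set} {φ : O → Real} {n} {c e v s : Vec ℕ n → ℕ} →
            Computes φ c → Computes φ e → Computes φ v → Computes φ s →
            Computes φ (λ xs → pending (c xs) (e xs) (v xs) (s xs))
pending-C c-C e-C v-C s-C = tl-C (runᴺ-C c-C e-C v-C s-C)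

runᴺ-stops : ∀ c e v {s t} → s ≤′ t → pending c e v s ≡ 0 → runᴺ c e v t ≡ runᴺ c e v s
runᴺ-stops c e v ≤′-refl                     _ = refl
runᴺ-stops c e v {t = suc t} (≤′-step s≤t) h =
  trans (cong (stepᴺ c) (runᴺ-stops c e v s≤t h)) (stepᴺ-halted c _ h)

pending-mono : ∀ c e v {s t} → s ≤ t → pending c e v s ≡ 0 → pending c e v t ≡ 0
pending-mono c e v s≤t h = trans (cong tl (runᴺ-stops c e v (≤⇒≤′ s≤t) h)) h

module _ {O : Set} {φ : O → Real} {n} (p : Rec O n) {xs : Vec ℕ n} where

  runᴺ-complete : ∀ {c} → (∀ o x → Eventually λ k → ∃[ r ] drop x (c k) ≡ cons (φ o x) r) →
                  ∀ {y} → φ ⊢ p [ xs ]⇓ y →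
                  ∃[ k ] ∃[ s ] runᴺ (c k) ⌜ compile p ⌝ᴵ ⌜ xs ⌝ⱽ s ≡ cons y 0
  runᴺ-complete {c} query p⇓ =
    let k , ev = evaluates c query p⇓
        s , eq = ev ≤-refl []
    in k , s , trans (runᴺ-run (c k) (compile p) ⌜ xs ⌝ⱽ s) (cong ⌜_⌝ eq)

  pending-sound : ∀ {X} → (∀ o i → φ o i ≡ X i) → ∀ k s →
                  pending (prefix X k) ⌜ compile p ⌝ᴵ ⌜ xs ⌝ⱽ s ≡ 0 → ∃[ y ] φ ⊢ p [ xs ]⇓ y
  pending-sound {X} φ≗X k s h = let y , p⇓ , _ = sound φ≗X k p xs s [] halts in y , p⇓
    where
    ⌜⌝ᴷ≡0 : ∀ K → ⌜ K ⌝ᴷ ≡ 0 → K ≡ []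
    ⌜⌝ᴷ≡0 []      _  = refl
    ⌜⌝ᴷ≡0 (I ∷ K) eq = contradiction eq (cons≢0 ⌜ I ⌝ᴵ ⌜ K ⌝ᴷ)
    halts : Halts (prefix X k) s (⌜ xs ⌝ⱽ , compile p ∷ [])
    halts = ⌜⌝ᴷ≡0 _ (trans (sym (tl-cons _ _))
      (trans (cong tl (sym (runᴺ-run (prefix X k) (compile p) ⌜ xs ⌝ⱽ s))) h))

module _ (p : Rec ⊥ 2) (x n : ℕ) where

  pending⁺ : ∃[ y ] noOracle ⊢ p [ x ∷ n ∷ [] ]⇓ y →
             ∃[ s ] pending 0 ⌜ compile p ⌝ᴵ ⌜ x ∷ n ∷ [] ⌝ⱽ s ≡ 0
  pending⁺ (y , p⇓) =
    let _ , s , eq = runᴺ-complete p {c = λ _ → 0} (λ ()) p⇓ in s , trans (cong tl eq) (tl-cons y 0)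

  pending⁻ : ∃[ s ] pending 0 ⌜ compile p ⌝ᴵ ⌜ x ∷ n ∷ [] ⌝ⱽ s ≡ 0 →
             ∃[ y ] noOracle ⊢ p [ x ∷ n ∷ [] ]⇓ y
  pending⁻ (s , h) = pending-sound p {X = λ _ → 0} (λ ()) 0 s h

-- Bounded search through neighbourhoods

∏<-zero⁺ : ∀ (f : ℕ → ℕ) {r i} → i < r → f i ≡ 0 → ∏< r f ≡ 0
∏<-zero⁺ f {suc r} i<1+r fi≡0 with m≤n⇒m<n∨m≡n (≤-pred i<1+r)
... | inj₁ i<r  = trans (cong (f r *_) (∏<-zero⁺ f i<r fi≡0)) (*-zeroʳ (f r))
... | inj₂ refl = cong (_* ∏< r f) fi≡0

∏<-zero⁻ : ∀ (f : ℕ → ℕ) r → ∏< r f ≡ 0 → ∃[ i ] i < r × f i ≡ 0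
∏<-zero⁻ f (suc r) eq with m*n≡0⇒m≡0∨n≡0 (f r) eq
... | inj₁ fr≡0 = r , ≤-refl , fr≡0
... | inj₂ rest = let i , i<r , fi≡0 = ∏<-zero⁻ f r rest in i , m<n⇒m<1+n i<r , fi≡0

∏<-cong : ∀ {f g : ℕ → ℕ} r → (∀ i → i < r → f i ≡ g i) → ∏< r f ≡ ∏< r g
∏<-cong zero    f≗g = refl
∏<-cong (suc r) f≗g = cong₂ _*_ (f≗g r ≤-refl) (∏<-cong r λ i i<r → f≗g i (m<n⇒m<1+n i<r))

searchAt : (e : ℕ) (X : Real) (n s k : ℕ) → ℕ
searchAt e X n s k = pending 0 e (cons (prefix X k) (cons n 0)) s

-- search e X n s vanishes iff some (X ↾ k , n) with k ≤ s enters the e-th c.e. set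
-- within s steps.
search : ℕ → Real → ℕ → ℕ → ℕ
search e X n s = ∏< (suc s) (searchAt e X n s)

search-mono : ∀ e X n {s t} → s ≤ t → search e X n s ≡ 0 → search e X n t ≡ 0
search-mono e X n {s} {t} s≤t h =
  let k , k<1+s , h′ = ∏<-zero⁻ (searchAt e X n s) (suc s) h in
  ∏<-zero⁺ (searchAt e X n t) (≤-trans k<1+s (s≤s s≤t)) (pending-mono 0 e _ s≤t h′)

infix 4 _≈[_]_
_≈[_]_ : Real → ℕ → Real → Set
X ≈[ k ] Y = ∀ i → i < k → X i ≡ Y i

prefix-cong : ∀ k {X Y} → X ≈[ k ] Y → prefix X k ≡ prefix Y k
prefix-cong zero    X≈Y = refl
prefix-cong (suc k) X≈Y =
  cong₂ (λ a b → 2 ^ a * (1 + 2 * b)) (X≈Y 0 z<s) (prefix-cong k λ i i<k → X≈Y (suc i) (s<s i<k))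

≈-≤ : ∀ {X Y j k} → j ≤ k → X ≈[ k ] Y → X ≈[ j ] Y
≈-≤ j≤k X≈Y i i<j = X≈Y i (≤-trans i<j j≤k)

-- Stage `s` inspects only prefixes of length at most `s`.
search-local : ∀ e n s {X Y} → X ≈[ s ] Y → search e X n s ≡ search e Y n s
search-local e n s X≈Y = ∏<-cong (suc s) λ k k<1+s →
  cong (λ c → pending 0 e (cons c (cons n 0)) s) (prefix-cong k (≈-≤ (≤-pred k<1+s) X≈Y))

module _ {O : Set} {φ : O → Real} where

  private
    C : ∀ {n} → (Vec ℕ n → ℕ) → Set
    C = Computes φ

  -- A list code grows at its head, so primitive recursion assembles the prefix from its last entry
  -- backwards, adding entry `k ∸ suc j` in round `j`.
  prefix-C : ∀ {n} {X : Vec ℕ (1 + n) → ℕ} {k : Vec ℕ n → ℕ} → C X → C k →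
             C (λ xs → prefix (λ i → X (i ∷ xs)) (k xs))
  prefix-C {X = X} {k} X-C k-C = respects (λ xs → eq (λ i → X (i ∷ xs)) (k xs))
    (natrec-C (const-C 0) (cons-C (at-C X-C (∸-C (at-C (weaken-C k-C) v₀) (suc-C v₀))) v₁) k-C)
    where
    eq : ∀ X k → natrec 0 (λ j → cons (X (k ∸ suc j))) k ≡ prefix X k
    eq X k = trans (segment k ≤-refl) (prefix-cong k λ i _ → cong (λ j → X (j + i)) (n∸n≡0 k))
      where
      -- After `j` rounds the last `j` of the `k` entries have been collected.
      segment : ∀ j → j ≤ k → natrec 0 (λ j → cons (X (k ∸ suc j))) j ≡ prefix (λ i → X (k ∸ j + i)) j
      segment zero    _   = refl
      segment (suc j) j<k = trans
        (cong₂ cons (cong X (sym (+-identityʳ (k ∸ suc j))))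
          (trans (segment j (<⇒≤ j<k)) (prefix-cong j λ i _ → cong X (shift i j<k))))
        (sym (code-∷ _ (applyUpTo (λ i → X (k ∸ suc j + suc i)) j)))
        where
        shift : ∀ {k} i → j < k → k ∸ j + i ≡ k ∸ suc j + suc i
        shift {suc k} i (s≤s j≤k) = trans (cong (_+ i) (+-∸-assoc 1 j≤k)) (sym (+-suc (k ∸ j) i))

  opaque

    search-C : ∀ {n} {e m s : Vec ℕ n → ℕ} {X : Vec ℕ (1 + n) → ℕ} → C e → C X → C m → C s →
               C (λ xs → search (e xs) (λ i → X (i ∷ xs)) (m xs) (s xs))
    search-C e-C X-C m-C s-C = ∏-C
      (pending-C (const-C 0) (weaken-C e-C)
        (cons-C (prefix-C (at-C X-C v₀) v₀) (cons-C (weaken-C m-C) (const-C 0))) (weaken-C s-C))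
      (suc-C s-C)

-- Compactness of Cantor space

Binary : Real → Set
Binary X = ∀ i → X i ≤ 1

-- Every number is read as a binary sequence, nonzero entries counting as 1, so no code has to be
-- rejected when all prefixes are tried.
bits : ℕ → Real
bits c i = if0 entry c i then 0 else 1

bits-binary : ∀ c → Binary (bits c)
bits-binary c i with entry c i
... | zero  = z≤n
... | suc _ = ≤-refl

bits-prefix : ∀ {X} → Binary X → ∀ s → X ≈[ s ] bits (prefix X s)
bits-prefix {X} bin s i i<s =
  trans (digit (bin i)) (cong (λ a → if0 a then 0 else 1) (sym (entry-prefix X i<s)))
  where
  digit : ∀ {a} → a ≤ 1 → a ≡ (if0 a then 0 else 1)
  digit z≤n       = refl
  digit (s≤s z≤n) = refl

-- A leading bit contributes a factor of at most 2 and `1 + 2 * c` roughly another. The bound makes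
-- quantification over binary prefixes of length `s` finite.
prefix<4^ : ∀ {X} → Binary X → ∀ s → prefix X s < 4 ^ s
prefix<4^ bin zero    = z<s
prefix<4^ {X} bin (suc s) = begin-strict
  2 ^ X 0 * (1 + 2 * c) ≤⟨ *-monoˡ-≤ (1 + 2 * c) (^-monoʳ-≤ 2 (bin 0)) ⟩
  2 * (1 + 2 * c)       <⟨ *-monoʳ-< 2 (s<s (n<1+n (2 * c))) ⟩
  2 * (2 + 2 * c)       ≡⟨ cong (2 *_) (sym (*-suc 2 c)) ⟩
  2 * (2 * suc c)       ≡⟨ sym (*-assoc 2 2 (suc c)) ⟩
  4 * suc c             ≤⟨ *-monoʳ-≤ 4 (prefix<4^ (bin ∘ suc) s) ⟩
  4 * 4 ^ s             ∎
  where
  open ≤-Reasoning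
  c = prefix (X ∘ suc) s

∑<-zero⁻ : ∀ (f : ℕ → ℕ) r → ∑< r f ≡ 0 → ∀ i → i < r → f i ≡ 0
∑<-zero⁻ f (suc r) eq i i<1+r with m≤n⇒m<n∨m≡n (≤-pred i<1+r)
... | inj₁ i<r  = ∑<-zero⁻ f r (m+n≡0⇒n≡0 (f r) eq) i i<r
... | inj₂ refl = m+n≡0⇒m≡0 (f i) eq

-- value n X s ≡ 0 says that X is found at stage s to belong to the n-th member of a
-- uniformly computable family of open sets.
record Family : Set where
  field
    value   : ℕ → Real → ℕ → ℕ
    local   : ∀ n s {X Y} → X ≈[ s ] Y → value n X s ≡ value n Y s
    mono    : ∀ n X {s t} → s ≤ t → value n X s ≡ 0 → value n X t ≡ 0
    value-C : Computes noOracle {3} λ xs →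
               value (lookup xs (suc zero)) (bits (lookup xs zero)) (lookup xs (suc (suc zero)))

  -- The codes below `4 ^ s` include all binary prefixes of length `s`, so by locality this
  -- computable sum vanishes exactly when all of Cantor space is covered at stage `s`.
  uncovered : ℕ → ℕ → ℕ
  uncovered n s = ∑< (4 ^ s) λ c → value n (bits c) s

  Covers : ℕ → ℕ → Set
  Covers n s = ∀ X → Binary X → value n X s ≡ 0

  uncovered⁻ : ∀ n s → uncovered n s ≡ 0 → Covers n s
  uncovered⁻ n s eq X bin = trans (local n s (bits-prefix bin s))
    (∑<-zero⁻ (λ c → value n (bits c) s) (4 ^ s) eq (prefix X s) (prefix<4^ bin s))

  uncovered⁺ : ∀ n s → Covers n s → uncovered n s ≡ 0
  uncovered⁺ n s covers = ∑<-zero (4 ^ s) λ c _ → covers (bits c) (bits-binary c)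

open Family

uncovered-C : ∀ {n} (F : Family) {a s : Vec ℕ n → ℕ} → Computes noOracle a → Computes noOracle s →
              Computes noOracle (λ xs → uncovered F (a xs) (s xs))
uncovered-C F a-C s-C = ∑-C (Family.value-C F ⟨ v₀ ∷ weaken-C a-C ∷ weaken-C s-C ∷ [] ⟩) (^-C 4 s-C)

-- Stage `suc i` is the first at which the coherence assumed in `limit-≈` has settled digit `i`.
limit : (ℕ → Real) → Real
limit S i = S (suc i) i

limit-≈ : ∀ {S} → (∀ k → S (suc k) ≈[ k ] S k) → ∀ k → limit S ≈[ k ] S k
limit-≈ {S} coherent k i i<k = sym (constant (≤⇒≤′ i<k))
  where
  constant : ∀ {k} → suc i ≤′ k → S k i ≡ S (suc i) i
  constant ≤′-refl                 = refl
  constant {suc k} (≤′-step i<k) = trans (coherent k i (≤′⇒≤ i<k)) (constant i<k)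

toC : ∀ {h} → Computable h → Computes noOracle {1} (λ xs → h (lookup xs zero))
toC (p , p⇓) = computes p λ { (x ∷ []) → p⇓ x }

fromC : ∀ {h} → Computes noOracle {1} (λ xs → h (lookup xs zero)) → Computable h
fromC (computes p p⇓) = p , λ n → p⇓ (n ∷ [])

update : Real → ℕ → ℕ → Real
update b k v i with i ≟ k
... | yes _ = v
... | no  _ = b i

update-≈ : ∀ b k v → update b k v ≈[ k ] b
update-≈ b k v i i<k with i ≟ k
... | yes refl = contradiction i<k (<-irrefl refl)
... | no _     = refl

module Classical (em : ExcludedMiddle (Level.suc 0ℓ)) where

  em₀ : ∀ {P : Set} → Dec P
  em₀ = map′ lower lift em

  dne : ∀ {P : Set} → ¬ ¬ P → P
  dne = decidable-stable em₀

  -- Otherwise choose digits one by one, keeping the neighbourhood uncovered at all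
  -- stages; the sequence so obtained is never covered.
  fan : ∀ (F : Family) n → (∀ X → Binary X → ∃[ s ] value F n X s ≡ 0) → ∃[ s ] Covers F n s
  fan F n covered = dne λ uncoverable →
    let s , eq = covered (limit S) λ i → binary (suc i) i
        Y , _ , Y≈ , ne = bad uncoverable s s
    in ne (trans (local F n s λ i i<s → trans (Y≈ i i<s) (sym (limit-≈ coherent s i i<s))) eq)
    where
    Bad : Real → ℕ → Set
    Bad b k = ∀ s → ∃[ Y ] Binary Y × Y ≈[ k ] b × value F n Y s ≢ 0

    digit : Real → ℕ → ℕ
    digit b k with em₀ {Bad (update b k 0) (suc k)}
    ... | yes _ = 0
    ... | no  _ = 1

    digit≤1 : ∀ b k → digit b k ≤ 1
    digit≤1 b k with em₀ {Bad (update b k 0) (suc k)}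
    ... | yes _ = z≤n
    ... | no  _ = ≤-refl

    S : ℕ → Real
    S zero    = λ _ → 0
    S (suc k) = update (S k) k (digit (S k) k)

    coherent : ∀ k → S (suc k) ≈[ k ] S k
    coherent k = update-≈ (S k) k _

    binary : ∀ k → Binary (S k)
    binary zero    i = z≤n
    binary (suc k) i with i ≟ k
    ... | yes _ = digit≤1 (S k) k
    ... | no  _ = binary k i

    ≈-update : ∀ {Y b k v} → Y ≈[ k ] b → Y k ≡ v → Y ≈[ suc k ] update b k v
    ≈-update {k = k} Y≈b Yk≡v i i<1+k with i ≟ k
    ... | yes refl = Yk≡v
    ... | no  i≢k  = Y≈b i (≤∧≢⇒< (≤-pred i<1+k) i≢k)

    bad-digit : ∀ b k → Bad b k → Bad (update b k (digit b k)) (suc k)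
    bad-digit b k bad with em₀ {Bad (update b k 0) (suc k)}
    ... | yes bad₀ = bad₀
    -- By monotonicity a sequence uncovered at `s ⊔ t` is uncovered at both stages. If none with
    -- digit 1 were uncovered at `s`, it would have digit 0, making 0 bad at every `t`.
    ... | no ¬bad₀ = λ s → dne λ ¬bad₁ → ¬bad₀ λ t →
      let Y , bin , Y≈ , ne = bad (s ⊔ t) in
      [ (λ Yk≡0 → Y , bin , ≈-update Y≈ Yk≡0 , ne ∘ mono F n Y (m≤n⊔m s t))
      , (λ Yk≡1 → contradiction (Y , bin , ≈-update Y≈ Yk≡1 , ne ∘ mono F n Y (m≤m⊔n s t)) ¬bad₁)
      ]′ (zero-or-one (bin k))
      where
      zero-or-one : ∀ {a} → a ≤ 1 → a ≡ 0 ⊎ a ≡ 1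
      zero-or-one z≤n       = inj₁ refl
      zero-or-one (s≤s z≤n) = inj₂ refl

    bad : ¬ ∃ (Covers F n) → ∀ k → Bad (S k) k
    bad uncoverable zero s = dne λ none → uncoverable
      (s , λ Y bin → dne λ ne → none (Y , bin , (λ _ ()) , ne))
    bad uncoverable (suc k) = bad-digit (S k) k (bad uncoverable k)

  opaque

    -- Compactness gives some covering stage for each `n`; since `uncovered` is computable, the
    -- least one is found by minimization, uniformly in `n`.
    covering-time : ∀ (F : Family) → (∀ n X → Binary X → ∃[ s ] value F n X s ≡ 0) →
                    ∃[ h ] Computable h × (∀ n → Covers F n (h n))
    covering-time F covered = h ,
      fromC (minimum-C {h = λ xs → h (lookup xs zero)} (uncovered-C F v₁ v₀)
        (λ { (n ∷ []) → proj₁ (proj₂ (first n)) }) (λ { (n ∷ []) → proj₂ (proj₂ (first n)) })) ,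
      λ n → uncovered⁻ F n (h n) (proj₁ (proj₂ (first n)))
      where
      first : ∀ n → ∃[ m ] uncovered F n m ≡ 0 × (∀ {i} → i < m → uncovered F n i ≢ 0)
      first n = let s , covers = fan F n (covered n) in least (uncovered F n) s (uncovered⁺ F n s covers)
      h : ℕ → ℕ
      h n = proj₁ (first n)

-- Open sets and computable functions

length-code : ∀ σ τ → code σ ≡ code τ → length σ ≡ length τ
length-code []      []      _  = refl
length-code []      (b ∷ τ) eq = contradiction (trans (sym (code-∷ b τ)) (sym eq)) (cons≢0 b (code τ))
length-code (a ∷ σ) []      eq = contradiction (trans (sym (code-∷ a σ)) eq) (cons≢0 a (code σ))
length-code (a ∷ σ) (b ∷ τ) eq = cong suc (length-code σ τ (proj₂ (cons-injective a (code σ) b (code τ)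
  (trans (sym (code-∷ a σ)) (trans eq (code-∷ b τ))))))

Σ⁰₁-resp-≐ : ∀ {Q R : Pred (Real × ℕ) 0ℓ} → Q ≐ R → Σ⁰₁ Q → Σ⁰₁ R
Σ⁰₁-resp-≐ (Q⊆R , R⊆Q) (W , ce , Q⊆W , W⊆Q) = W , ce , Q⊆W ∘ R⊆Q , Q⊆R ∘ W⊆Q

-- The index is the code of the compiled program enumerating the neighbourhoods.
Σ⁰₁⇒search : ∀ {Q} → Σ⁰₁ Q → ∃[ e ] ∀ X n → Q (X , n) ⇔ (∃[ s ] search e X n s ≡ 0)
Σ⁰₁⇒search {Q} (W , (p , ce) , Q⊆W , W⊆Q) = e , λ X n → mk⇔ (found X n) (correct X n)
  where
  e : ℕ
  e = ⌜ compile p ⌝ᴵ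
  found : ∀ X n → Q (X , n) → ∃[ s ] search e X n s ≡ 0
  found X n q =
    let σ , w , σ≡ = Q⊆W q
        s , h = pending⁺ p (code σ) n (Equivalence.to (ce σ n) w)
        -- The stage of a search bounds both the running time and the length of the prefix.
        t = s ⊔ length σ
    in t , ∏<-zero⁺ (searchAt e X n t) (s≤s (m≤n⊔m s (length σ)))
         (pending-mono 0 e _ (m≤m⊔n s (length σ))
           (subst (λ c → pending 0 e (cons c (cons n 0)) s ≡ 0) (cong code σ≡) h))
  correct : ∀ X n → ∃[ s ] search e X n s ≡ 0 → Q (X , n)
  correct X n (s , h) =
    let k , _ , h′ = ∏<-zero⁻ (searchAt e X n s) (suc s) h
    in W⊆Q (applyUpTo X k , Equivalence.from (ce _ n) (pending⁻ p (prefix X k) n (s , h′)) ,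
            cong (applyUpTo X) (sym (length-applyUpTo X k)))

Σ⁰₁[]⇒search : ∀ {f B} → Σ⁰₁[ f ] B → ∃[ e ] ∀ n → B n ⇔ (∃[ s ] search e f n s ≡ 0)
Σ⁰₁[]⇒search {f} (Q , Q-Σ , B⊆Q , Q⊆B) =
  let e , equiv = Σ⁰₁⇒search Q-Σ
  in e , λ n → mk⇔ (Equivalence.to (equiv f n) ∘ B⊆Q) (Q⊆B ∘ Equivalence.from (equiv f n))

module _ (T : Real → ℕ → ℕ) {h : ℕ → ℕ} (h-computable : Computable h)
         (T-local : ∀ n {X Y} → X ≈[ h n ] Y → T X n ≡ T Y n) where

  -- As `T X n` depends only on `X` below `h n`, it can be evaluated on prefixes of exactly that
  -- length.
  zeros-Σ⁰₁ : Computes noOracle {2} (λ xs → T (entry (lookup xs zero)) (lookup xs (suc zero))) →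
              Σ⁰₁ (λ (X , n) → T X n ≡ 0)
  zeros-Σ⁰₁ T-C = (λ (σ , n) → R (code σ) n ≡ 0) ,
    -- Minimization over a dummy argument converges exactly where `R` vanishes, turning a decidable
    -- set into a domain.
    (minᴿ (program (weaken-C R-C)) , λ σ n → mk⇔
       (λ eq → minᴿ-defined⁺ (weaken-C R-C) {s = 0} eq)
       (λ (_ , p⇓) → minᴿ-defined⁻ (weaken-C R-C) p⇓)) ,
    (λ {(X , n)} → member X n) , (λ {(X , n)} → correct X n)
    where
    -- The first summand vanishes exactly when `c` codes a sequence of length `h n`.
    R : ℕ → ℕ → ℕ
    R c n = dist c (prefix (entry c) (h n)) + T (entry c) n
    R-C : Computes noOracle {2} (λ xs → R (lookup xs zero) (lookup xs (suc zero)))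
    R-C = +-C (dist-C v₀ (prefix-C (hd-C (drop-C v₀ v₁)) (toC h-computable ⟨ v₁ ∷ [] ⟩))) T-C
    member : ∀ X n → T X n ≡ 0 → ∃[ σ ] R (code σ) n ≡ 0 × σ ≡ applyUpTo X (length σ)
    member X n eq = applyUpTo X (h n) ,
      cong₂ _+_ (trans (cong (dist c) (sym (prefix-cong (h n) X≈))) (dist-refl c))
                (trans (sym (T-local n X≈)) eq) ,
      cong (applyUpTo X) (sym (length-applyUpTo X (h n)))
      where
      c = prefix X (h n)
      X≈ : X ≈[ h n ] entry c
      X≈ i i<hn = sym (entry-prefix X i<hn)
    correct : ∀ X n → ∃[ σ ] R (code σ) n ≡ 0 × σ ≡ applyUpTo X (length σ) → T X n ≡ 0
    correct X n (σ , eq , σ≡) = trans (T-local n X≈) (m+n≡0⇒n≡0 (dist (code σ) _) eq)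
      where
      length≡ : length σ ≡ h n
      length≡ = trans
        (length-code σ (applyUpTo (entry (code σ)) (h n)) (dist≡0⇒≡ (m+n≡0⇒m≡0 _ eq)))
        (length-applyUpTo _ (h n))
      X≈ : X ≈[ h n ] entry (code σ)
      X≈ i i<hn = sym (trans (cong (λ τ → entry (code τ) i) σ≡)
        (entry-prefix X (subst (i <_) (sym length≡) i<hn)))

1∸-zero⁺ : ∀ {a} → a ≢ 0 → 1 ∸ a ≡ 0
1∸-zero⁺ {zero}  a≢0 = contradiction refl a≢0
1∸-zero⁺ {suc a} _   = 0∸n≡0 a

1∸-zero⁻ : ∀ {a} → 1 ∸ a ≡ 0 → a ≢ 0
1∸-zero⁻ () refl

zeros-Δ⁰₁ : ∀ (T : Real → ℕ → ℕ) {h} → Computable h →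
            (∀ n {X Y} → X ≈[ h n ] Y → T X n ≡ T Y n) →
            Computes noOracle {2} (λ xs → T (entry (lookup xs zero)) (lookup xs (suc zero))) →
            Δ⁰₁ (λ (X , n) → T X n ≡ 0)
zeros-Δ⁰₁ T h-computable T-local T-C = zeros-Σ⁰₁ T h-computable T-local T-C ,
  Σ⁰₁-resp-≐ (1∸-zero⁻ , 1∸-zero⁺)
    (zeros-Σ⁰₁ (λ X n → 1 ∸ T X n) h-computable (λ n X≈Y → cong (1 ∸_) (T-local n X≈Y))
      (∸-C (const-C 1) T-C))

opaque

  -- Dummy minimization gives an oracle program `p` that, with oracle `A`, converges exactly at the
  -- zeros of `f`. The neighbourhoods are the finite oracles with which the machine for `p` halts.
  zeros-Σ⁰₁[] : ∀ {A f : Real} → Computes (λ (_ : ⊤) → A) {1} (λ xs → f (lookup xs zero)) →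
                Σ⁰₁[ A ] (λ n → f n ≡ 0)
  zeros-Σ⁰₁[] {A} {f} f-C = ⋃⟦ W ⟧ , (W , ce , (λ w → w) , (λ w → w)) ,
    (λ {n} → member n) , (λ {n} → correct n)
    where
    g-C : Computes (λ (_ : ⊤) → A) {2} (λ xs → f (lookup xs (suc zero)))
    g-C = f-C ⟨ v₁ ∷ [] ⟩
    p : Rec ⊤ 1
    p = minᴿ (program g-C)
    halted-C : Computes noOracle {3} (λ xs → pending (lookup xs (suc zero)) ⌜ compile p ⌝ᴵ
                                           (cons (lookup xs (suc (suc zero))) 0) (lookup xs zero))
    halted-C = pending-C v₁ (const-C _) (cons-C v₂ (const-C 0)) v₀
    W : Pred (List ℕ × ℕ) 0ℓ
    W (σ , n) = ∃[ s ] pending (code σ) ⌜ compile p ⌝ᴵ ⌜ n ∷ [] ⌝ⱽ s ≡ 0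
    ce : CE W
    ce = minᴿ (program halted-C) , λ σ n →
      mk⇔ (λ (s , eq) → minᴿ-defined⁺ halted-C {s = s} eq) (λ (s , p⇓) → s , minᴿ-defined⁻ halted-C p⇓)
    member : ∀ n → f n ≡ 0 → ⋃⟦ W ⟧ (A , n)
    member n eq =
      let _ , p⇓ = minᴿ-defined⁺ g-C {n ∷ []} {0} eq
          k , s , halted = runᴺ-complete p {c = prefix A} (λ _ x → suc x , drop-prefix< A) p⇓
      in applyUpTo A k , (s , trans (cong tl halted) (tl-cons _ 0)) ,
         cong (applyUpTo A) (sym (length-applyUpTo A k))
    correct : ∀ n → ⋃⟦ W ⟧ (A , n) → f n ≡ 0
    correct n (σ , (s , halted) , σ≡) =
      let _ , p⇓ = pending-sound p {n ∷ []} {A} (λ _ _ → refl) (length σ) s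
                     (subst (λ τ → pending (code τ) ⌜ compile p ⌝ᴵ ⌜ n ∷ [] ⌝ⱽ s ≡ 0) σ≡ halted)
      in minᴿ-defined⁻ g-C p⇓

-- Pairs of searches and tame reals

searchFamily : ℕ → Family
searchFamily e = record
  { value   = λ n X → search e X n
  ; local   = search-local e
  ; mono    = λ n X → search-mono e X n
  ; value-C = search-C (const-C e) (if0-C (hd-C (drop-C v₀ v₁)) (const-C 0) (const-C 1)) v₁ v₂
  }

infixl 7 _⊗_
-- The memberwise union of the open sets: a product vanishes when one of its factors does.
_⊗_ : Family → Family → Family
F ⊗ G = record
  { value   = λ n X s → value F n X s * value G n X s
  ; local   = λ n s X≈Y → cong₂ _*_ (local F n s X≈Y) (local G n s X≈Y)
  ; mono    = λ n X {s} {t} s≤t eq → [ (λ F≡0 → cong (_* value G n X t) (mono F n X s≤t F≡0))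
                             , (λ G≡0 → trans (cong (value F n X t *_) (mono G n X s≤t G≡0)) (*-zeroʳ (value F n X t)))
                             ]′ (m*n≡0⇒m≡0∨n≡0 (value F n X s) eq)
  ; value-C = *-C (value-C F) (value-C G)
  }

module _ (F G : Family) {n : ℕ} {X : Real} where

  ⊗-zero⁺ : (∃[ s ] value F n X s ≡ 0) ⊎ (∃[ s ] value G n X s ≡ 0) → ∃[ s ] value (F ⊗ G) n X s ≡ 0
  ⊗-zero⁺ (inj₁ (s , eq)) = s , cong (_* value G n X s) eq
  ⊗-zero⁺ (inj₂ (s , eq)) = s , trans (cong (value F n X s *_) eq) (*-zeroʳ (value F n X s))

Tame : Real → Set
Tame A = ∀ e e′ → let F = searchFamily e ⊗ searchFamily e′ in
  (∀ n → ∃[ s ] value F n A s ≡ 0) → ∃[ h ] Computable h × (∀ n → value F n A (h n) ≡ 0)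

-- The first successful stage is a function computable from `A`; by monotonicity of the searches, a
-- computable bound on it serves as well.
dominated⇒tame : ∀ {A} → ComputablyDominated A → Tame A
dominated⇒tame {A} dominated e e′ found =
  let h , h-computable , g≤h = dominated g g≤A
  in h , h-computable , λ n → mono F n A (g≤h n) (proj₁ (proj₂ (first n)))
  where
  F = searchFamily e ⊗ searchFamily e′
  first : ∀ n → ∃[ m ] value F n A m ≡ 0 × (∀ {i} → i < m → value F n A i ≢ 0)
  first n = let s , eq = found n in least (value F n A) s eq
  g : ℕ → ℕ
  g n = proj₁ (first n)
  F-C : Computes (λ (_ : ⊤) → A) {2} (λ xs → value F (lookup xs (suc zero)) A (lookup xs zero))
  F-C = *-C (search-C (const-C e) (oracle-C tt v₀) v₁ v₀) (search-C (const-C e′) (oracle-C tt v₀) v₁ v₀)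
  g-C : Computes (λ (_ : ⊤) → A) {1} (λ xs → g (lookup xs zero))
  g-C = minimum-C F-C (λ { (n ∷ []) → proj₁ (proj₂ (first n)) })
                      (λ { (n ∷ []) → proj₂ (proj₂ (first n)) })
  g≤A : g ≤T A
  g≤A = program g-C , λ n → converges g-C (n ∷ [])

-- Strong relativization and computable domination

module Relativization (em : ExcludedMiddle (Level.suc 0ℓ)) where

  open Classical em

  tame⇒strong : ∀ {A} → Tame A → StronglyRelativizesΔ⁰₁ A
  tame⇒strong {A} tame B (B-Σ , ∁B-Σ) =
    (λ (X , n) → search e X n (h n) ≡ 0) ,
    zeros-Δ⁰₁ (λ X n → search e X n (h n)) h-computable (λ n → search-local e n (h n))
      (search-C (const-C e) (hd-C (drop-C v₀ v₁)) v₁ (toC h-computable ⟨ v₁ ∷ [] ⟩)) ,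
    (λ {n} → B⇒found n) , (λ {n} eq → Equivalence.from (B⇔ n) (h n , eq))
    where
    e  = proj₁ (Σ⁰₁[]⇒search B-Σ)
    B⇔ = proj₂ (Σ⁰₁[]⇒search B-Σ)
    e′  = proj₁ (Σ⁰₁[]⇒search ∁B-Σ)
    ∁B⇔ = proj₂ (Σ⁰₁[]⇒search ∁B-Σ)
    F = searchFamily e ⊗ searchFamily e′
    found : ∀ n → ∃[ s ] value F n A s ≡ 0
    found n with em₀ {B n}
    ... | yes b = ⊗-zero⁺ (searchFamily e) (searchFamily e′) (inj₁ (Equivalence.to (B⇔ n) b))
    ... | no ¬b = ⊗-zero⁺ (searchFamily e) (searchFamily e′) (inj₂ (Equivalence.to (∁B⇔ n) ¬b))
    bound = tame e e′ found
    h = proj₁ bound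
    h-computable = proj₁ (proj₂ bound)
    B⇒found : ∀ n → B n → search e A n (h n) ≡ 0
    B⇒found n b with m*n≡0⇒m≡0∨n≡0 (search e A n (h n)) (proj₂ (proj₂ bound) n)
    ... | inj₁ eq = eq
    -- By stage `h n` one search has succeeded, and at a member of `B` it cannot be the one for the
    -- complement.
    ... | inj₂ eq = contradiction b (Equivalence.from (∁B⇔ n) (h n , eq))

  -- The searches for `Q` and its complement together cover Cantor space, so one of them succeeds by
  -- the covering time; at a member it is the search for `Q`.
  Δ⁰₁⇒bounded-search : ∀ {Q} → Δ⁰₁ Q → ∃[ e ] ∃[ h ] Computable h ×
    (∀ X n → ∃[ s ] search e X n s ≡ 0 → Q (X , n)) ×
    (∀ X n → Binary X → Q (X , n) → search e X n (h n) ≡ 0)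
  Δ⁰₁⇒bounded-search {Q} (Q-Σ , ∁Q-Σ) with Σ⁰₁⇒search Q-Σ | Σ⁰₁⇒search ∁Q-Σ
  ... | e , Q⇔ | e′ , ∁Q⇔ with covering-time (searchFamily e ⊗ searchFamily e′) found
    where
    found : ∀ n X → Binary X → ∃[ s ] value (searchFamily e ⊗ searchFamily e′) n X s ≡ 0
    found n X _ with em₀ {Q (X , n)}
    ... | yes q = ⊗-zero⁺ (searchFamily e) (searchFamily e′) (inj₁ (Equivalence.to (Q⇔ X n) q))
    ... | no ¬q = ⊗-zero⁺ (searchFamily e) (searchFamily e′) (inj₂ (Equivalence.to (∁Q⇔ X n) ¬q))
  ... | h , h-computable , covers = e , h , h-computable ,
    (λ X n → Equivalence.from (Q⇔ X n)) ,
    (λ X n X-bin q → [ id , (λ eq → contradiction q (Equivalence.from (∁Q⇔ X n) (h n , eq))) ]′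
      (m*n≡0⇒m≡0∨n≡0 (search e X n (h n)) (covers n X X-bin)))

  module _ {A} (A-bin : Binary A) (strong : StronglyRelativizesΔ⁰₁ A)
           (g : Real) (g-C : Computes (λ (_ : ⊤) → A) {1} (λ xs → g (lookup xs zero))) where

    private
      -- The pair `n` is itself the argument of the search it names, so that a set can be confronted
      -- with its own index.
      b : ℕ → ℕ
      b n = search (hd n) A n (g (tl n))

      B : Pred ℕ 0ℓ
      B n = b n ≢ 0

      B-Δ : Δ⁰₁[ A ] B
      B-Δ =
        let Q , Q-Σ , Q⊆ , ⊆Q = zeros-Σ⁰₁[] {A} {λ n → 1 ∸ b n} (∸-C (const-C 1) b-C)
            R , R-Σ , R⊆ , ⊆R = zeros-Σ⁰₁[] {A} {b} b-C
        in (Q , Q-Σ , (λ {n} ne → Q⊆ {n} (1∸-zero⁺ ne)) , (λ {n} q → 1∸-zero⁻ (⊆Q {n} q))) ,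
           (R , R-Σ , (λ {n} ¬ne → R⊆ {n} (decidable-stable (b n ≟ 0) ¬ne)) , (λ {n} r ne → ne (⊆R {n} r)))
        where
        b-C : Computes (λ (_ : ⊤) → A) {1} (λ xs → b (lookup xs zero))
        b-C = search-C (hd-C v₀) (oracle-C tt v₀) v₀ (g-C ⟨ tl-C v₀ ∷ [] ⟩)

      b-cons : ∀ e m → b (cons e m) ≡ search e A (cons e m) (g m)
      b-cons e m = cong₂ (λ i j → search i A (cons e m) (g j)) (hd-cons e m) (tl-cons e m)

      bound : (∃[ Q ] Δ⁰₁ Q × B ≐ section Q A) → ∃[ h ] Computable h × (∀ n → g n ≤ h n)
      bound (Q , Q-Δ , B⊆Q , Q⊆B) =
        let e , h , h-computable , sound , bounded = Δ⁰₁⇒bounded-search Q-Δ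

            -- Success within `g m` steps would put `cons e m` into `B`, whose definition says that
            -- there is no such success.
            late : ∀ m → search e A (cons e m) (g m) ≢ 0
            late m eq = Q⊆B (sound A (cons e m) (g m , eq)) (trans (b-cons e m) eq)

            found : ∀ m → search e A (cons e m) (h (cons e m)) ≡ 0
            found m = bounded A (cons e m) A-bin (B⊆Q (subst (_≢ 0) (sym (b-cons e m)) (late m)))

        in (λ m → h (cons e m)) , fromC (toC h-computable ⟨ cons-C (const-C e) v₀ ∷ [] ⟩) ,
           λ m → <⇒≤ (≰⇒> λ h≤g → late m (search-mono e A (cons e m) h≤g (found m)))

    strong⇒dominating : ∃[ h ] Computable h × (∀ n → g n ≤ h n)
    strong⇒dominating = bound (strong B B-Δ)

  strong⇒dominated : ∀ {A} → Binary A → StronglyRelativizesΔ⁰₁ A → ComputablyDominated A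
  strong⇒dominated A-bin strong g (p , p⇓) =
    strong⇒dominating A-bin strong g (computes p λ { (x ∷ []) → p⇓ x })

-- Forcing with Π⁰₁ classes

-- Only index 0 of a family is relevant when it stands for a Π⁰₁ class.
infix 4 _∈ᴾ_
_∈ᴾ_ : Real → Family → Set
X ∈ᴾ F = Binary X × (∀ s → value F 0 X s ≢ 0)

-- Freezing the index turns one open set into a family, which can then be joined to every member of
-- another or stand for a class.
fix : ℕ → Family → Family
fix n F = record
  { value   = λ _ → value F n
  ; local   = λ _ → local F n
  ; mono    = λ _ → mono F n
  ; value-C = value-C F ⟨ v₀ ∷ const-C n ∷ v₂ ∷ [] ⟩
  }

-- Enlarging the open complement of `P` by the `n`-th open set of `G` leaves those members of `P` at
-- which that search never succeeds.
refine : Family → Family → ℕ → Family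
refine P G n = fix n (fix 0 P ⊗ G)

module _ (P G : Family) (n : ℕ) {X : Real} where

  refine⁺ : X ∈ᴾ P → (∀ s → value G n X s ≢ 0) → X ∈ᴾ refine P G n
  refine⁺ (bin , P≢0) G≢0 = bin , λ s eq →
    [ P≢0 s , G≢0 s ]′ (m*n≡0⇒m≡0∨n≡0 (value P 0 X s) eq)

  refine⊆ : X ∈ᴾ refine P G n → X ∈ᴾ P
  refine⊆ (bin , ≢0) = bin , λ s eq → ≢0 s (cong (_* value G n X s) eq)

  refine≢0 : X ∈ᴾ refine P G n → ∀ s → value G n X s ≢ 0
  refine≢0 (_ , ≢0) s eq = ≢0 s (trans (cong (value P 0 X s *_) eq) (*-zeroʳ (value P 0 X s)))

-- The `k`-th open set is that of all `X` with `X k ≢ v`, so refining by it imposes `X k ≡ v`.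
-- Before stage `suc k` the value is 1, since locality forbids reading digit `k`.
digit : ℕ → Family
digit v = record
  { value   = val
  ; local   = loc
  ; mono    = mon
  ; value-C = if0-C (∸-C (suc-C v₁) v₂)
      (∸-C (const-C 1) (dist-C (if0-C (hd-C (drop-C v₁ v₀)) (const-C 0) (const-C 1)) (const-C v)))
      (const-C 1)
  }
  where
  val : ℕ → Real → ℕ → ℕ
  val k X s = if0 suc k ∸ s then 1 ∸ dist (X k) v else 1
  loc : ∀ k s {X Y} → X ≈[ s ] Y → val k X s ≡ val k Y s
  loc k s X≈Y with suc k ∸ s in eq
  ... | zero  = cong (λ a → 1 ∸ dist a v) (X≈Y k (m∸n≡0⇒m≤n eq))
  ... | suc _ = refl
  mon : ∀ k X {s t} → s ≤ t → val k X s ≡ 0 → val k X t ≡ 0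
  mon k X {s} s≤t eq with suc k ∸ s in k<s
  ... | zero = trans (if0-≡0 _ _ (m≤n⇒m∸n≡0 (≤-trans (m∸n≡0⇒m≤n {suc k} k<s) s≤t))) eq

digit⁺ : ∀ v k X → X k ≡ v → ∀ s → value (digit v) k X s ≢ 0
digit⁺ v k X refl s eq with suc k ∸ s
... | zero = contradiction (trans (cong (1 ∸_) (sym (dist-refl v))) eq) λ ()

digit⁻ : ∀ v k X → (∀ s → value (digit v) k X s ≢ 0) → X k ≡ v
digit⁻ v k X ≢0 with X k ≟ v
... | yes eq = eq
... | no ne  = contradiction
  (trans (if0-≡0 _ _ (n∸n≡0 k)) (1∸-zero⁺ (ne ∘ dist≡0⇒≡))) (≢0 (suc k))

clash : Real → ℕ → ℕ → ℕ
clash X s n = pending 0 n (cons n 0) s + dist (X n) (hd (runᴺ 0 n (cons n 0) s))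

-- The members of this Π⁰₁ class differ at n from the output, if any, of the n-th
-- machine on input n.
diagonal : Family
diagonal = record
  { value   = λ _ X s → ∏< s (clash X s)
  ; local   = λ _ s X≈Y → ∏<-cong s λ n n<s →
      cong (λ a → pending 0 n (cons n 0) s + dist a (hd (runᴺ 0 n (cons n 0) s))) (X≈Y n n<s)
  ; mono    = mon
  ; value-C = ∏-C (+-C (pending-C (const-C 0) v₀ (cons-C v₀ (const-C 0)) v₃)
      (dist-C (if0-C (hd-C (drop-C v₀ v₁)) (const-C 0) (const-C 1))
              (hd-C (runᴺ-C (const-C 0) v₀ (cons-C v₀ (const-C 0)) v₃)))) v₂
  }
  where
  mon : ∀ _ X {s t} → s ≤ t → ∏< s (clash X s) ≡ 0 → ∏< t (clash X t) ≡ 0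
  mon _ X {s} {t} s≤t eq =
    let n , n<s , clash≡0 = ∏<-zero⁻ (clash X s) s eq
        halted = m+n≡0⇒m≡0 (pending 0 n (cons n 0) s) clash≡0
    in ∏<-zero⁺ (clash X t) (≤-trans n<s s≤t)
         (trans (cong (λ st → tl st + dist (X n) (hd st)) (runᴺ-stops 0 n (cons n 0) (≤⇒≤′ s≤t) halted)) clash≡0)

diagonal⁻ : ∀ X s → value diagonal 0 X s ≡ 0 →
            ∃[ n ] pending 0 n (cons n 0) s ≡ 0 × X n ≡ hd (runᴺ 0 n (cons n 0) s)
diagonal⁻ X s eq =
  let n , _ , clash≡0 = ∏<-zero⁻ (clash X s) s eq
  in n , m+n≡0⇒m≡0 (pending 0 n (cons n 0) s) clash≡0 ,
     dist≡0⇒≡ (m+n≡0⇒n≡0 (pending 0 n (cons n 0) s) clash≡0)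

diagonal-noncomputable : ∀ {X} → X ∈ᴾ diagonal → ¬ Computable X
diagonal-noncomputable {X} (_ , ≢0) (p , p⇓) =
  let n = ⌜ compile p ⌝ᴵ
      _ , s , eq = runᴺ-complete p {n ∷ []} {c = λ _ → 0} (λ ()) (p⇓ n)
      -- The product at stage `t` ranges over machines below `t`, so `t` must exceed `n` as well as
      -- reach the halting time.
      t = suc n ⊔ s
      eq′ = trans (runᴺ-stops 0 n (cons n 0) (≤⇒≤′ (m≤n⊔m (suc n) s)) (trans (cong tl eq) (tl-cons _ 0))) eq
  in ≢0 t (∏<-zero⁺ (clash X t) (m≤m⊔n (suc n) s)
       (cong₂ _+_ (trans (cong tl eq′) (tl-cons _ 0))
         (trans (cong (dist (X n)) (trans (cong hd eq′) (hd-cons _ 0))) (dist-refl (X n)))))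

TameAt : ℕ → ℕ → Real → Set
TameAt e e′ X = let F = searchFamily e ⊗ searchFamily e′ in
  (∀ n → ∃[ s ] value F n X s ≡ 0) → ∃[ h ] Computable h × (∀ n → value F n X (h n) ≡ 0)

record Class : Set where
  field
    family        : Family
    point         : Real
    point∈        : point ∈ᴾ family
    noncomputable : ∀ {X} → X ∈ᴾ family → ¬ Computable X

open Class

infix 4 _⊑_
_⊑_ : Class → Class → Set
P ⊑ Q = ∀ {X} → X ∈ᴾ family P → X ∈ᴾ family Q

refineClass : ∀ P G n {X} → X ∈ᴾ refine (family P) G n → Class
refineClass P G n {X} X∈ = record
  { family        = refine (family P) G n
  ; point         = X
  ; point∈        = X∈
  ; noncomputable = noncomputable P ∘ refine⊆ (family P) G n
  }

module Forcing (em : ExcludedMiddle (Level.suc 0ℓ)) where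

  open Classical em

  -- The value 0 of X n avoids all outputs but 0.
  diagonalClass : Class
  diagonalClass = record
    { family = diagonal ; point = X ; point∈ = binary , avoids ; noncomputable = diagonal-noncomputable }
    where
    ZeroOutput : ℕ → Set
    ZeroOutput n = ∃[ s ] pending 0 n (cons n 0) s ≡ 0 × hd (runᴺ 0 n (cons n 0) s) ≡ 0
    choose : ∀ {P : Set} → Dec P → ℕ
    choose (yes _) = 1
    choose (no _)  = 0
    X : Real
    X n = choose (em₀ {ZeroOutput n})
    binary : Binary X
    binary n with em₀ {ZeroOutput n}
    ... | yes _ = ≤-refl
    ... | no _  = z≤n
    avoids : ∀ s → value diagonal 0 X s ≢ 0
    avoids s eq with diagonal⁻ X s eq
    ... | n , halted , Xn≡ with em₀ {ZeroOutput n}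
    ... | no ¬zero = ¬zero (s , halted , sym Xn≡)
    ... | yes (r , halted′ , zero-output) = contradiction
      (trans Xn≡ (trans (cong hd (trans
        (sym (runᴺ-stops 0 n (cons n 0) (≤⇒≤′ (m≤m⊔n s r)) halted))
        (runᴺ-stops 0 n (cons n 0) (≤⇒≤′ (m≤n⊔m s r)) halted′))) zero-output)) λ ()

  empty⇒covered : ∀ P G n → ¬ (∃[ X ] X ∈ᴾ refine P G n) →
                  ∀ X → Binary X → ∃[ s ] value (fix 0 P ⊗ G) n X s ≡ 0
  empty⇒covered P G n empty X bin = dne λ never → empty (X , bin , λ s eq → never (s , eq))

  opaque

    force : ∀ e e′ P → Σ Class λ P′ → P′ ⊑ P × (∀ {X} → X ∈ᴾ family P′ → TameAt e e′ X)
    force e e′ P = decide em₀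
      where
      F : Family
      F = searchFamily e ⊗ searchFamily e′
      decide : Dec (∃[ n ] ∃[ X ] X ∈ᴾ refine (family P) F n) →
               Σ Class λ P′ → P′ ⊑ P × (∀ {X} → X ∈ᴾ family P′ → TameAt e e′ X)
      decide (yes (n , X , X∈)) = refineClass P F n X∈ , refine⊆ (family P) F n ,
        -- The premise of `TameAt` fails at `n` for every member of the subclass.
        λ Y∈ found → let s , eq = found n in contradiction eq (refine≢0 (family P) F n Y∈ s)
      decide (no never) =
        let h , h-computable , covers = covering-time (fix 0 (family P) ⊗ F)
              λ n → empty⇒covered (family P) F n λ (X , X∈) → never (n , X , X∈)
        -- At stage `h n` either `X` is seen outside the class, impossible for a member, or one of
        -- the searches has succeeded.
        in P , id , λ {X} (bin , ≢0) _ → h , h-computable , λ n →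
          [ (λ eq → contradiction eq (≢0 (h n))) , id ]′
            (m*n≡0⇒m≡0∨n≡0 (value (family P) 0 X (h n)) (covers n X bin))

    -- Otherwise, for each k, compactness reveals at some stage the only value that
    -- members of the class can take at k, so its members are computable.
    splits : ∀ P → ∃[ k ] (∀ (a : Fin 2) → ∃[ X ] X ∈ᴾ refine (family P) (digit (toℕ a)) k)
    splits P = dne λ unsplit → noncomputable P (point∈ P) (computable unsplit)
      where
      side : ℕ → Family
      side v = fix 0 (family P) ⊗ digit v
      computable : ¬ (∃[ k ] (∀ (a : Fin 2) → ∃[ X ] X ∈ᴾ refine (family P) (digit (toℕ a)) k)) →
                   Computable (point P)
      computable unsplit = fromC (respects (λ { (k ∷ []) → sym (point≡ k) })
        -- At the computed time at least one digit is ruled out at `k`; the output is 1 if 0 is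
        -- ruled out, and 0 otherwise.
        (if0-C (uncovered-C (side 0) v₀ time-C) (const-C 1) (const-C 0)))
        where
        V : ℕ → ℕ → ℕ → ℕ
        V v = uncovered (side v)
        empty⇒V≡0 : ∀ v k → ¬ (∃[ X ] X ∈ᴾ refine (family P) (digit v) k) → ∃[ s ] V v k s ≡ 0
        empty⇒V≡0 v k empty =
          let s , covers = fan (side v) k (empty⇒covered (family P) (digit v) k empty)
          in s , uncovered⁺ (side v) k s covers
        V≡0⇒≢ : ∀ v k s → V v k s ≡ 0 → point P k ≢ v
        V≡0⇒≢ v k s eq Xk≡v = [ proj₂ (point∈ P) s , digit⁺ v k (point P) Xk≡v s ]′
          (m*n≡0⇒m≡0∨n≡0 (value (family P) 0 (point P) s)
            (uncovered⁻ (side v) k s eq (point P) (proj₁ (point∈ P))))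
        revealed : ∀ k → Dec (∃[ X ] X ∈ᴾ refine (family P) (digit 0) k) → ∃[ s ] V 0 k s * V 1 k s ≡ 0
        revealed k (no empty) =
          let s , eq = empty⇒V≡0 0 k empty in s , cong (_* V 1 k s) eq
        revealed k (yes X∈) =
          let s , eq = empty⇒V≡0 1 k λ Y∈ → unsplit (k , λ { zero → X∈ ; (suc zero) → Y∈ })
          in s , trans (cong (V 0 k s *_) eq) (*-zeroʳ (V 0 k s))
        first : ∀ k → ∃[ m ] V 0 k m * V 1 k m ≡ 0 × (∀ {i} → i < m → V 0 k i * V 1 k i ≢ 0)
        first k = let s , eq = revealed k em₀ in least (λ s → V 0 k s * V 1 k s) s eq
        time : ℕ → ℕ
        time k = proj₁ (first k)
        time-C : Computes noOracle {1} (λ xs → time (lookup xs zero))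
        time-C = minimum-C (*-C (uncovered-C (side 0) v₁ v₀) (uncovered-C (side 1) v₁ v₀))
          (λ { (k ∷ []) → proj₁ (proj₂ (first k)) }) (λ { (k ∷ []) → proj₂ (proj₂ (first k)) })
        point≡ : ∀ k → point P k ≡ (if0 V 0 k (time k) then 1 else 0)
        point≡ k with V 0 k (time k) in V₀ | m*n≡0⇒m≡0∨n≡0 (V 0 k (time k)) (proj₁ (proj₂ (first k)))
                    | proj₁ (point∈ P) k
        ... | zero  | _         | bin = ≤-antisym bin (n≢0⇒n>0 (V≡0⇒≢ 0 k (time k) V₀))
        ... | suc _ | inj₁ ()   | bin
        ... | suc _ | inj₂ V₁≡0 | bin = n<1⇒n≡0 (≤∧≢⇒< bin (V≡0⇒≢ 1 k (time k) V₁≡0))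

  -- The tree of classes and its branches

  module Stage (i : ℕ) (P : Class) where

    forced : Class
    forced = proj₁ (force (hd i) (tl i) P)

    position : ℕ
    position = proj₁ (splits forced)

    side : Fin 2 → Class
    side a = refineClass forced (digit (toℕ a)) position (proj₂ (proj₂ (splits forced) a))

    -- After forcing tameness for the pair coded by `i` and splitting, digit `i` is frozen at that
    -- of the current point, so that the points along a branch converge.
    next : Fin 2 → Class
    next a = refineClass (side a) (digit (point (side a) i)) i {point (side a)}
      (refine⁺ (family (side a)) (digit (point (side a) i)) i (point∈ (side a)) (digit⁺ _ i (point (side a)) refl))

    module _ (a : Fin 2) {X : Real} (X∈ : X ∈ᴾ family (next a)) where

      next-digit : X i ≡ point (next a) i
      next-digit = digit⁻ _ i X (refine≢0 (family (side a)) (digit (point (side a) i)) i X∈)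

      next-side : X ∈ᴾ family (side a)
      next-side = refine⊆ (family (side a)) (digit (point (side a) i)) i X∈

      next-position : X position ≡ toℕ a
      next-position = digit⁻ _ position X (refine≢0 (family forced) (digit (toℕ a)) position next-side)

      next-forced : X ∈ᴾ family forced
      next-forced = refine⊆ (family forced) (digit (toℕ a)) position next-side

      next-tame : TameAt (hd i) (tl i) X
      next-tame = proj₂ (proj₂ (force (hd i) (tl i) P)) next-forced

      next⊑ : X ∈ᴾ family P
      next⊑ = proj₁ (proj₂ (force (hd i) (tl i) P)) next-forced

  open Stage

  node : (ℕ → Fin 2) → ℕ → Class
  node α zero    = diagonalClass
  node α (suc i) = next i (node α i) (α i)

  points : (ℕ → Fin 2) → ℕ → Real
  points α i = point (node α i)

  branchReal : (ℕ → Fin 2) → Real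
  branchReal α = limit (points α)

  node-⊑ : ∀ α {i j} → i ≤′ j → node α j ⊑ node α i
  node-⊑ α ≤′-refl                 X∈ = X∈
  node-⊑ α {j = suc j} (≤′-step i≤j) X∈ = node-⊑ α i≤j (next⊑ j (node α j) (α j) X∈)

  node-≈ : ∀ α k {X} → X ∈ᴾ family (node α k) → X ≈[ k ] points α k
  node-≈ α (suc k) X∈ i i<1+k with m≤n⇒m<n∨m≡n (≤-pred i<1+k)
  ... | inj₂ refl = next-digit k (node α k) (α k) X∈
  ... | inj₁ i<k  = trans (node-≈ α k (next⊑ k (node α k) (α k) X∈) i i<k)
    (sym (node-≈ α k (next⊑ k (node α k) (α k) (point∈ (node α (suc k)))) i i<k))

  branchReal-≈ : ∀ α k → branchReal α ≈[ k ] points α k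
  branchReal-≈ α = limit-≈ λ k → node-≈ α k (next⊑ k (node α k) (α k) (point∈ (node α (suc k))))

  -- Classes are closed: stage `s` reads only `s` digits, on which the limit agrees with the point
  -- of node `i ⊔ s`, a member of node `i`.
  branchReal∈ : ∀ α i → branchReal α ∈ᴾ family (node α i)
  branchReal∈ α i = (λ j → proj₁ (point∈ (node α (suc j))) j) , λ s eq →
    let k = i ⊔ s
        _ , ≢0 = node-⊑ α (≤⇒≤′ (m≤m⊔n i s)) (point∈ (node α k))
    in ≢0 s (trans (sym (local (family (node α i)) 0 s (≈-≤ (m≤n⊔m i s) (branchReal-≈ α k)))) eq)

  branchReal-tame : ∀ α → Tame (branchReal α)
  branchReal-tame α e e′ =
    let i = cons e e′ in
    subst₂ (λ e e′ → TameAt e e′ (branchReal α)) (hd-cons e e′) (tl-cons e e′)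
      (next-tame i (node α i) (α i) (branchReal∈ α (suc i)))

  -- A node consults finitely many values of its path, so pointwise equality yields propositional
  -- equality of classes without function extensionality.
  node-cong : ∀ {α β} → (∀ i → α i ≡ β i) → ∀ i → node α i ≡ node β i
  node-cong α≗β zero    = refl
  node-cong α≗β (suc i) = cong₂ (next i) (node-cong α≗β i) (α≗β i)

  branchReal-cong : ∀ {α β} → (∀ i → α i ≡ β i) → ∀ i → branchReal α i ≡ branchReal β i
  branchReal-cong α≗β i = cong (λ P → point P i) (node-cong α≗β (suc i))

  -- While the nodes coincide, both paths split at the same position, where the digit of the real
  -- records the direction taken; hence the next nodes coincide too.
  branchReal-injective : ∀ {α β} → (∀ i → branchReal α i ≡ branchReal β i) → ∀ i → α i ≡ β i
  branchReal-injective {α} {β} eq i = same-direction i (same-node i)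
    where
    same-direction : ∀ i → node α i ≡ node β i → α i ≡ β i
    same-direction i node≡ = toℕ-injective (begin
      toℕ (α i)                               ≡⟨ sym (next-position i (node α i) (α i) (branchReal∈ α (suc i))) ⟩
      branchReal α (position i (node α i))    ≡⟨ eq _ ⟩
      branchReal β (position i (node α i))    ≡⟨ cong (λ P → branchReal β (position i P)) node≡ ⟩
      branchReal β (position i (node β i))    ≡⟨ next-position i (node β i) (β i) (branchReal∈ β (suc i)) ⟩
      toℕ (β i)                               ∎)
      where open ≡-Reasoning
    same-node : ∀ i → node α i ≡ node β i
    same-node zero    = refl
    same-node (suc i) = cong₂ (next i) (same-node i) (same-direction i (same-node i))

-- The Cantor–Schröder–Bernstein theorem for setoids

iterate : ∀ {a} {A : Set a} → (A → A) → ℕ → A → A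
iterate f zero    x = x
iterate f (suc n) x = f (iterate f n x)

module CantorSchröderBernstein {a b c d : Level} (X : Setoid a b) (Y : Setoid c d)
         (em : ExcludedMiddle (a Level.⊔ b Level.⊔ c))
         (F : Injection X Y) (G : Injection Y X) where

  open Setoid X using (Carrier; _≈_) renaming (sym to ≈-sym; trans to ≈-trans; refl to ≈-refl)
  module Y = Setoid Y
  open Injection F using () renaming (to to f; cong to f-cong; injective to f-injective)
  open Injection G using () renaming (to to g; cong to g-cong; injective to g-injective)

  InImage : Carrier → Set (b Level.⊔ c)
  InImage x = ∃[ y ] g y ≈ x

  -- These are the points whose chain, traced backwards, starts in `X` outside the image of `g`.
  -- There `f` is followed; elsewhere `g` is inverted.
  Originates : Carrier → Set (a Level.⊔ b Level.⊔ c)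
  Originates x = ∃[ n ] ∃[ x₀ ] ¬ InImage x₀ × iterate (g ∘ f) n x₀ ≈ x

  -- As a relation, it can be shown to respect both equalities independently of the case
  -- distinctions made by `total`.
  data Corresponds (x : Carrier) (y : Y.Carrier) : Set (a Level.⊔ b Level.⊔ c Level.⊔ d) where
    forward  : Originates x → f x Y.≈ y → Corresponds x y
    backward : ¬ Originates x → g y ≈ x → Corresponds x y

  originates-≈ : ∀ {x x′} → x ≈ x′ → Originates x → Originates x′
  originates-≈ x≈x′ (n , x₀ , ∉ , eq) = n , x₀ , ∉ , ≈-trans eq x≈x′

  originates-gf : ∀ {x} → Originates x → Originates (g (f x))
  originates-gf (n , x₀ , ∉ , eq) = suc n , x₀ , ∉ , g-cong (f-cong eq)

  inImage? : ∀ x → Dec (InImage x)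
  inImage? x = map′ lower lift (em {Lift a (InImage x)})

  total : ∀ x → ∃[ y ] Corresponds x y
  total x with em {Originates x}
  ... | yes o = f x , forward o Y.refl
  ... | no ¬o =
    let y , gy≈x = decidable-stable (inImage? x) λ ∉ → ¬o (0 , x , ∉ , ≈-refl)
    in y , backward ¬o gy≈x

  functional : ∀ {x x′ y y′} → x ≈ x′ → Corresponds x y → Corresponds x′ y′ → y Y.≈ y′
  functional x≈x′ (forward _ fx≈y) (forward _ fx′≈y′) =
    Y.trans (Y.sym fx≈y) (Y.trans (f-cong x≈x′) fx′≈y′)
  functional x≈x′ (backward _ gy≈x) (backward _ gy′≈x′) =
    g-injective (≈-trans gy≈x (≈-trans x≈x′ (≈-sym gy′≈x′)))
  functional x≈x′ (forward o _) (backward ¬o _) = contradiction (originates-≈ x≈x′ o) ¬o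
  functional x≈x′ (backward ¬o _) (forward o _) = contradiction (originates-≈ (≈-sym x≈x′) o) ¬o

  injective : ∀ {x x′ y y′} → y Y.≈ y′ → Corresponds x y → Corresponds x′ y′ → x ≈ x′
  injective y≈y′ (forward _ fx≈y) (forward _ fx′≈y′) =
    f-injective (Y.trans fx≈y (Y.trans y≈y′ (Y.sym fx′≈y′)))
  injective y≈y′ (backward _ gy≈x) (backward _ gy′≈x′) =
    ≈-trans (≈-sym gy≈x) (≈-trans (g-cong y≈y′) gy′≈x′)
  injective y≈y′ (forward o fx≈y) (backward ¬o gy′≈x′) = contradiction
    (originates-≈ (≈-trans (g-cong (Y.trans fx≈y y≈y′)) gy′≈x′) (originates-gf o)) ¬o
  injective y≈y′ (backward ¬o gy≈x) (forward o fx′≈y′) = contradiction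
    (originates-≈ (≈-trans (g-cong (Y.trans fx′≈y′ (Y.sym y≈y′))) gy≈x) (originates-gf o)) ¬o

  surjective : ∀ y → ∃[ x ] Corresponds x y
  surjective y with em {Originates (g y)}
  ... | no ¬o                        = g y , backward ¬o ≈-refl
  -- A chain of length zero would start at `g y`, which is in the image of `g`.
  ... | yes (zero , x₀ , ∉ , eq)     = contradiction (y , ≈-sym eq) ∉
  ... | yes (suc n , x₀ , ∉ , eq)    =
    iterate (g ∘ f) n x₀ , forward (n , x₀ , ∉ , ≈-refl) (g-injective eq)

  bijection : Bijection X Y
  bijection = record
    { to        = λ x → proj₁ (total x)
    ; cong      = λ {x} {x′} x≈x′ → functional x≈x′ (proj₂ (total x)) (proj₂ (total x′))
    ; bijective =
        (λ {x} {x′} y≈y′ → injective y≈y′ (proj₂ (total x)) (proj₂ (total x′))) ,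
        λ y → let x , x∼y = surjective y in x , λ {z} z≈x → functional z≈x (proj₂ (total z)) x∼y
    }

-- Coding reals by their graphs, and the theorem

graphDigit : ℕ → ℕ → Fin 2
graphDigit v w with v ≟ w
... | yes _ = suc zero
... | no _  = zero

graphDigit-refl : ∀ v → graphDigit v v ≡ suc zero
graphDigit-refl v with v ≟ v
... | yes _  = refl
... | no v≢v = contradiction refl v≢v

graphDigit≡1⇒≡ : ∀ v w → graphDigit v w ≡ suc zero → v ≡ w
graphDigit≡1⇒≡ v w eq with v ≟ w
... | yes v≡w = v≡w

graph : Real → ℕ → Fin 2
graph f n = graphDigit (f (hd n)) (tl n)

graph-injective : ∀ {f f′} → (∀ n → graph f n ≡ graph f′ n) → ∀ m → f m ≡ f′ m
graph-injective {f} {f′} eq m = sym (graphDigit≡1⇒≡ (f′ m) (f m) (begin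
  graphDigit (f′ m) (f m)   ≡⟨ cong₂ (λ i w → graphDigit (f′ i) w) (hd-cons m (f m)) (tl-cons m (f m)) ⟨
  graph f′ (cons m (f m))   ≡⟨ eq (cons m (f m)) ⟨
  graph f (cons m (f m))    ≡⟨ cong₂ (λ i w → graphDigit (f i) w) (hd-cons m (f m)) (tl-cons m (f m)) ⟩
  graphDigit (f m) (f m)    ≡⟨ graphDigit-refl (f m) ⟩
  suc zero                  ∎))
  where open ≡-Reasoning

toℕ-binary : ∀ (A : ℕ → Fin 2) → Binary (toℕ ∘ A)
toℕ-binary A i with A i
... | zero     = z≤n
... | suc zero = ≤-refl

theorem14 : ExcludedMiddle (Level.suc 0ℓ) →
    (∀ (A : ℕ → Fin 2) →
      StronglyRelativizesΔ⁰₁ (toℕ ∘ A) ⇔ ComputablyDominated (toℕ ∘ A))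
    × Bijection (ℕ →-setoid Fin 2) stronglyRelativizingReals
theorem14 em =
  (λ A → mk⇔ (strong⇒dominated (toℕ-binary A)) (tame⇒strong ∘ dominated⇒tame)) ,
  CantorSchröderBernstein.bijection (ℕ →-setoid Fin 2) stronglyRelativizingReals em
    (record { to        = λ α → branchReal α , tame⇒strong (branchReal-tame α)
            ; cong      = branchReal-cong
            ; injective = branchReal-injective })
    (record { to        = graph ∘ proj₁
            ; cong      = λ f≗f′ n → cong (λ v → graphDigit v (tl n)) (f≗f′ (hd n))
            ; injective = graph-injective })
  where
  open Relativization em
  open Forcing em
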